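{- For any constant $\epsilon>0$, the problem MMVC restricted to bipartite graphs cannot be solved in time $O^*((2-\epsilon)^{\frac{vc}{2}})$ unless the Strong Exponential Time Hypothesis (SETH) fails.
   Context: A vertex cover of a graph $G=(V,E)$ is a set of vertices containing at least one endpoint of every edge; it is minimal if no proper subset of it is a vertex cover. In the Maximal Minimal Vertex Cover problem (MMVC), the input is a graph $G=(V,E)$, and the task is to find the maximum size of a set $S\subseteq V$ that is a minimal vertex cover of $G$. $vc$ denotes the minimum size of a vertex cover of $G$. The notation $O^*$ hides factors polynomial in the input size. SETH is the standard hypothesis that for every $\delta>0$ there is an integer $k$ such that $k$-SAT on $n$ variables cannot be solved in time $O^*((2-\delta)^n)$. -}

module Defs where

open import Algebra.Definitions.RawSemiring using () renaming (_^_ to pow)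
open import Data.Bool.Base using (Bool; true; false)
open import Data.Fin.Base using (Fin; zero; toℕ)
open import Data.Fin.Subset using (Subset; _∈_; _∉_; _⊂_; ∣_∣)
open import Data.Integer.Base using (+_)
open import Data.List.Base as List using (List; []; _∷_)
open import Data.List.Relation.Unary.All using (All)
open import Data.List.Relation.Unary.Any using (Any)
open import Data.Nat.Base using (ℕ; zero; suc; _+_; _*_; _^_; _≤_; NonZero)
open import Data.Product.Base using (Σ; ∃; ∃-syntax; _×_; _,_; proj₁)
open import Data.Rational.Base as ℚ using (ℚ; 0ℚ)
open import Data.Sum.Base using (_⊎_)
open import Data.Vec.Base using (Vec; _∷_; lookup; replicate; _[_]≔_)
open import Relation.Binary.PropositionalEquality.Core using (_≡_; _≢_)
open import Relation.Nullary.Negation.Core using (¬_)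
open import Relation.Nullary.Reflects using (Reflects)

------------------------------------------------------------------------
-- Model of computation: the WHILE language over binary trees (N. D. Jones,
-- "Computability and Complexity from a Programming Perspective") with
-- unit-cost elementary operations.
--
-- Values are immutable, so a machine with pointers shares subtrees and
-- executes every operation below in constant time. Conversely, a random
-- access memory kept in a balanced tree costs a logarithmic factor per
-- access. Running times therefore agree with those of a word RAM up to
-- factors polylogarithmic in the running time and the input size; for
-- single-exponential running times these are absorbed by O*.

data Tree : Set where
  nil : Tree
  _∙_ : Tree → Tree → Tree

infixr 5 _∙_

size : Tree → ℕ
size nil     = 1
size (s ∙ t) = suc (size s + size t)

head tail : Tree → Tree
head nil     = nil
head (s ∙ t) = s
tail nil     = nil
tail (s ∙ t) = t

data Expr (m : ℕ) : Set where
  nil  : Expr m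
  var  : Fin m → Expr m
  cons : Expr m → Expr m → Expr m
  hd   : Expr m → Expr m
  tl   : Expr m → Expr m

infix  6 _:=_
infixr 5 _⨾_

data Cmd (m : ℕ) : Set where
  _:=_          : Fin m → Expr m → Cmd m
  _⨾_           : Cmd m → Cmd m → Cmd m
  if_then_else_ : Expr m → Cmd m → Cmd m → Cmd m
  while_repeat_    : Expr m → Cmd m → Cmd m

Store : ℕ → Set
Store m = Vec Tree m

eval : ∀ {m} → Expr m → Store m → Tree
eval nil        σ = nil
eval (var x)    σ = lookup σ x
eval (cons e f) σ = eval e σ ∙ eval f σ
eval (hd e)     σ = head (eval e σ)
eval (tl e)     σ = tail (eval e σ)

cost : ∀ {m} → Expr m → ℕ
cost nil        = 1
cost (var x)    = 1
cost (cons e f) = suc (cost e + cost f)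
cost (hd e)     = suc (cost e)
cost (tl e)     = suc (cost e)

-- ⟨ c , σ ⟩⇓⟨ τ , t ⟩: command c, started in store σ, halts in store τ
-- after t steps. As a test, nil is false and every other tree is true.

data ⟨_,_⟩⇓⟨_,_⟩ {m : ℕ} : Cmd m → Store m → Store m → ℕ → Set where
  assign : ∀ {x e σ} →
    ⟨ x := e , σ ⟩⇓⟨ σ [ x ]≔ eval e σ , suc (cost e) ⟩
  seq : ∀ {c d ρ σ τ s t} →
    ⟨ c , ρ ⟩⇓⟨ σ , s ⟩ → ⟨ d , σ ⟩⇓⟨ τ , t ⟩ →
    ⟨ c ⨾ d , ρ ⟩⇓⟨ τ , s + t ⟩
  if-true : ∀ {e c d σ τ t} → eval e σ ≢ nil →
    ⟨ c , σ ⟩⇓⟨ τ , t ⟩ →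
    ⟨ if e then c else d , σ ⟩⇓⟨ τ , suc (cost e + t) ⟩
  if-false : ∀ {e c d σ τ t} → eval e σ ≡ nil →
    ⟨ d , σ ⟩⇓⟨ τ , t ⟩ →
    ⟨ if e then c else d , σ ⟩⇓⟨ τ , suc (cost e + t) ⟩
  while-true : ∀ {e c ρ σ τ s t} → eval e ρ ≢ nil →
    ⟨ c , ρ ⟩⇓⟨ σ , s ⟩ → ⟨ while e repeat c , σ ⟩⇓⟨ τ , t ⟩ →
    ⟨ while e repeat c , ρ ⟩⇓⟨ τ , suc (cost e + (s + t)) ⟩
  while-false : ∀ {e c σ} → eval e σ ≡ nil →
    ⟨ while e repeat c , σ ⟩⇓⟨ σ , suc (cost e) ⟩

-- Variable zero holds the input at the start and the output at the end;
-- all other variables are initially nil.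

record Program : Set where
  field
    auxVars : ℕ
    body    : Cmd (suc auxVars)

_on_↦_inTime_ : Program → Tree → Tree → ℕ → Set
p on input ↦ output inTime t =
  ∃[ τ ] ⟨ body , input ∷ replicate auxVars nil ⟩⇓⟨ τ , t ⟩
       × lookup τ zero ≡ output
  where open Program p

------------------------------------------------------------------------
-- Encodings of data as trees; numbers are in unary.

encodeBool : Bool → Tree
encodeBool false = nil
encodeBool true  = nil ∙ nil

encodeℕ : ℕ → Tree
encodeℕ zero    = nil
encodeℕ (suc n) = nil ∙ encodeℕ n

encodeFin : ∀ {n} → Fin n → Tree
encodeFin i = encodeℕ (toℕ i)

encodePair : {A B : Set} → (A → Tree) → (B → Tree) → A × B → Tree
encodePair f g (a , b) = f a ∙ g b

encodeList : {A : Set} → (A → Tree) → List A → Tree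
encodeList f []       = nil
encodeList f (x ∷ xs) = f x ∙ encodeList f xs

------------------------------------------------------------------------
-- Problems and O*-running times

record Problem : Set₁ where
  field
    Instance  : Set
    encode    : Instance → Tree
    IsCorrect : Instance → Tree → Set

-- 2 − ε, truncated at 0 so that its real powers make sense for all ε > 0.

2−_ : ℚ → ℚ
2− ε = 0ℚ ℚ.⊔ ((+ 2 ℚ./ 1) ℚ.- ε)

-- t ≤ q · c ^ (k / d) for c ≥ 0, the root being eliminated by raising both
-- sides to the power d.

infix 4 _≤_·_^⟨_/_⟩

_≤_·_^⟨_/_⟩ : (t q : ℕ) (c : ℚ) (k d : ℕ) .{{_ : NonZero d}} → Set
t ≤ q · c ^⟨ k / d ⟩ =
  (+ (t ^ d) ℚ./ 1) ℚ.≤ (+ (q ^ d) ℚ./ 1) ℚ.* pow ℚ.+-*-rawSemiring c k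

-- P can be solved in time O*(c ^ (κ / d)), where κ x k says that k is the
-- parameter of the instance x. Since sizes are positive, every polynomial in
-- the input size s is bounded by some a * s ^ b.

SolvableInO* : (P : Problem) (c : ℚ) (κ : Problem.Instance P → ℕ → Set)
               (d : ℕ) .{{_ : NonZero d}} → Set
SolvableInO* P c κ d =
  ∃[ p ] ∃[ a ] ∃[ b ] ∀ (x : Instance) →
    ∃[ out ] ∃[ t ] ∃[ k ]
        (p on encode x ↦ out inTime t)
      × IsCorrect x out
      × κ x k
      × t ≤ a * size (encode x) ^ b · c ^⟨ k / d ⟩
  where open Problem P

------------------------------------------------------------------------
-- k-SAT and the Strong Exponential Time Hypothesis

-- The literal (true , i) is the variable i, (false , i) is its negation.

Literal : ℕ → Set
Literal n = Bool × Fin n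

record CNF : Set where
  field
    vars    : ℕ
    clauses : List (List (Literal vars))

  Satisfiable : Set
  Satisfiable = Σ (Fin vars → Bool) λ α →
    All (Any (λ (s , i) → α i ≡ s)) clauses

  HasWidth≤ : ℕ → Set
  HasWidth≤ k = All (λ c → List.length c ≤ k) clauses

  encodeCNF : Tree
  encodeCNF =
    encodeℕ vars ∙ encodeList (encodeList (encodePair encodeBool encodeFin)) clauses

_-SAT : ℕ → Problem
k -SAT = record
  { Instance  = Σ CNF λ φ → CNF.HasWidth≤ φ k
  ; encode    = λ (φ , _) → CNF.encodeCNF φ
  ; IsCorrect = λ (φ , _) out →
      ∃[ b ] out ≡ encodeBool b × Reflects (CNF.Satisfiable φ) b
  }

SETH : Set
SETH = ∀ (δ : ℚ) → 0ℚ ℚ.< δ →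
  ∃[ k ] ¬ SolvableInO* (k -SAT) (2− δ) (λ (φ , _) n → CNF.vars φ ≡ n) 1

------------------------------------------------------------------------
-- Graphs and vertex covers

-- Finite simple graphs on the vertex set Fin order. Edges are unordered:
-- orientation, order and repetition in the list are irrelevant below.

record Graph : Set where
  field
    order    : ℕ
    edges    : List (Fin order × Fin order)
    loopless : All (λ (u , v) → u ≢ v) edges

  VertexCover : Subset order → Set
  VertexCover S = All (λ (u , v) → u ∈ S ⊎ v ∈ S) edges

  MinimalVertexCover : Subset order → Set
  MinimalVertexCover S = VertexCover S × (∀ T → T ⊂ S → ¬ VertexCover T)

  IsVc : ℕ → Set
  IsVc k = (∃[ S ] VertexCover S × ∣ S ∣ ≡ k)
         × (∀ S → VertexCover S → k ≤ ∣ S ∣)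

  IsMMVC : ℕ → Set
  IsMMVC k = (∃[ S ] MinimalVertexCover S × ∣ S ∣ ≡ k)
           × (∀ S → MinimalVertexCover S → ∣ S ∣ ≤ k)

  Bipartite : Set
  Bipartite = ∃[ A ]
    All (λ (u , v) → (u ∈ A × v ∉ A) ⊎ (u ∉ A × v ∈ A)) edges

  encodeGraph : Tree
  encodeGraph = encodeℕ order ∙ encodeList (encodePair encodeFin encodeFin) edges

-- The bipartition is not part of the input.

BipartiteMMVC : Problem
BipartiteMMVC = record
  { Instance  = Σ Graph Graph.Bipartite
  ; encode    = λ (G , _) → Graph.encodeGraph G
  ; IsCorrect = λ (G , _) out → ∃[ k ] out ≡ encodeℕ k × Graph.IsMMVC G k
  }

vc : Problem.Instance BipartiteMMVC → ℕ → Set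
vc (G , _) = Graph.IsVc G

-- Given a CNF formula with n variables, pair the variables up and let each
-- pair contribute four literal vertices a, ¬a, b, ¬b and eight further
-- vertices: two joined to a and ¬a, two joined to b and ¬b, and one joined to
-- each {literal of a, literal of b}. Add a vertex per clause joined to the
-- literals of the clause. The literal vertices form a side of a bipartition,
-- so the vertex cover number is at most 4⌈n/2⌉ ≤ 2(n + 1).
--
-- The complement I of a minimal vertex cover is a maximal independent set. A
-- vertex that is not a literal lies in I iff none of its neighbours does,
-- which forces at least three vertices of each pair's gadget into I. If I
-- misses every clause vertex and has exactly three vertices in each gadget,
-- then I selects exactly one literal of each variable, and these satisfy all
-- clauses. Conversely a satisfying assignment yields such an I, since the
-- vertex joined to the two unselected literals dominates both. Hence
-- the formula is satisfiable iff MMVC ≥ |V| − 3⌈n/2⌉, and an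
-- O*((2 − ε)^(vc/2)) algorithm solves SAT in time O*((2 − min(ε,1))^n).

module Submission where

-- Maximality of `I` at the non-literal vertices makes a gadget contribute 8 vertices if no literal
-- is selected, 5 if one is, 4 if exactly the two literals of one variable are, 3 if one literal of
-- each variable is, 3 for any three literals, and 4 for all four. Doubling the vertices joined to
-- both literals of a variable raises the third of these cases to 4; with single copies it would tie
-- at 3. Three selected literals do reach 3, and only maximality at the fourth literal excludes
-- them: each of its gadget neighbours already sees a selected literal, so nothing but a clause
-- vertex could dominate it.
--
-- This dictates the order of the soundness argument. The lower bound 3 uses maximality at
-- non-literal vertices alone; counting then expels all clause vertices from `I`; only after that is
-- maximality at the literals a statement about a single gadget.
--
-- The model of computation is concrete, so the reduction also has to exist as WHILE code, with
-- polynomial bounds on its time and on its output size.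

open import Defs

-- Running-time bounds as inequalities between rationals.

module RationalBounds where

  open import Algebra.Bundles using (CommutativeMonoid)
  open import Algebra.Definitions.RawSemiring using () renaming (_^_ to pow)
  import Algebra.Properties.CommutativeSemigroup as CommutativeSemigroup
  open import Data.Integer.Base as ℤ using (+_)
  import Data.Integer.Properties as ℤ
  open import Data.Nat.Base as ℕ using (ℕ; zero; suc)
  import Data.Nat.Properties as ℕ
  open import Data.Rational.Base as ℚ
      using (ℚ; 0ℚ; 1ℚ; _≤_; _<_; _*_; _+_; _-_; _⊓_; toℚᵘ; nonNegative; positive)
  import Data.Rational.Properties as ℚ
  open import Data.Rational.Unnormalised.Base as ℚᵘ using (mkℚᵘ)
  import Data.Rational.Unnormalised.Properties as ℚᵘ
  open import Data.Sum.Base using (inj₁; inj₂)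
  open import Relation.Binary.PropositionalEquality
  import Relation.Binary.Reasoning.Setoid as SetoidReasoning
  open import Relation.Nullary

  ι : ℕ → ℚ
  ι n = + n ℚ./ 1

  toℚᵘ-ι : ∀ n → toℚᵘ (ι n) ℚᵘ.≃ mkℚᵘ (+ n) 0
  toℚᵘ-ι n = ℚ.toℚᵘ-fromℚᵘ (mkℚᵘ (+ n) 0)

  -- Normalisation by the gcd blocks computation in `ℚ` on open terms, so the identity is checked on
  -- unnormalised fractions with denominator 1.
  ι-+ : ∀ m n → ι (m ℕ.+ n) ≡ ι m + ι n
  ι-+ m n = ℚ.toℚᵘ-injective (begin
    toℚᵘ (ι (m ℕ.+ n))              ≈⟨ toℚᵘ-ι (m ℕ.+ n) ⟩
    mkℚᵘ (+ (m ℕ.+ n)) 0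
        ≡⟨ cong₂ (λ x y → mkℚᵘ (x ℤ.+ y) 0) (ℤ.*-identityʳ (+ m)) (ℤ.*-identityʳ (+ n)) ⟨
    mkℚᵘ (+ m) 0 ℚᵘ.+ mkℚᵘ (+ n) 0  ≈⟨ ℚᵘ.+-cong (toℚᵘ-ι m) (toℚᵘ-ι n) ⟨
    toℚᵘ (ι m) ℚᵘ.+ toℚᵘ (ι n)      ≈⟨ ℚ.toℚᵘ-homo-+ (ι m) (ι n) ⟨
    toℚᵘ (ι m + ι n)                ∎)
    where open SetoidReasoning ℚᵘ.≃-setoid

  ι-* : ∀ m n → ι (m ℕ.* n) ≡ ι m * ι n
  ι-* m n = ℚ.toℚᵘ-injective (begin
    toℚᵘ (ι (m ℕ.* n))              ≈⟨ toℚᵘ-ι (m ℕ.* n) ⟩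
    mkℚᵘ (+ (m ℕ.* n)) 0            ≡⟨ cong (λ z → mkℚᵘ z 0) (ℤ.pos-* m n) ⟩
    mkℚᵘ (+ m) 0 ℚᵘ.* mkℚᵘ (+ n) 0  ≈⟨ ℚᵘ.*-cong (toℚᵘ-ι m) (toℚᵘ-ι n) ⟨
    toℚᵘ (ι m) ℚᵘ.* toℚᵘ (ι n)      ≈⟨ ℚ.toℚᵘ-homo-* (ι m) (ι n) ⟨
    toℚᵘ (ι m * ι n)                ∎)
    where open SetoidReasoning ℚᵘ.≃-setoid

  ι-mono : ∀ {m n} → m ℕ.≤ n → ι m ≤ ι n
  ι-mono {m} {n} m≤n = ℚ.toℚᵘ-cancel-≤ (begin
    toℚᵘ (ι m)    ≃⟨ toℚᵘ-ι m ⟩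
    mkℚᵘ (+ m) 0  ≤⟨ ℚᵘ.*≤* (ℤ.*-monoʳ-≤-nonNeg (+ 1) (ℤ.+≤+ m≤n)) ⟩
    mkℚᵘ (+ n) 0  ≃⟨ toℚᵘ-ι n ⟨
    toℚᵘ (ι n)    ∎)
    where open ℚᵘ.≤-Reasoning

  0≤ι : ∀ n → 0ℚ ≤ ι n
  0≤ι n = ι-mono {0} {n} ℕ.z≤n

  *-mono-≤ : ∀ {p q r s} → 0ℚ ≤ p → 0ℚ ≤ s → p ≤ q → r ≤ s → p * r ≤ q * s
  *-mono-≤ {p} {q} {r} {s} 0≤p 0≤s p≤q r≤s = ℚ.≤-trans
    (ℚ.*-monoˡ-≤-nonNeg p {{nonNegative 0≤p}} r≤s) (ℚ.*-monoʳ-≤-nonNeg s {{nonNegative 0≤s}} p≤q)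

  square-cancel-≤ : ∀ {p q} → 0ℚ ≤ q → p * p ≤ q * q → p ≤ q
  square-cancel-≤ {p} {q} 0≤q p²≤q² with p ℚ.≤? q
  ... | yes p≤q = p≤q
  ... | no p≰q  = contradiction (ℚ.≤-<-trans p²≤q² (begin-strict
    q * q  ≤⟨ ℚ.*-monoˡ-≤-nonNeg q {{nonNegative 0≤q}} (ℚ.<⇒≤ q<p) ⟩
    q * p  <⟨ ℚ.*-monoˡ-<-pos p {{positive (ℚ.≤-<-trans 0≤q q<p)}} q<p ⟩
    p * p  ∎)) (ℚ.<-irrefl refl)
    where
    open ℚ.≤-Reasoning
    q<p = ℚ.≰⇒> p≰q

  *-interchange : ∀ p q r s → (p * q) * (r * s) ≡ (p * r) * (q * s)
  *-interchange = CommutativeSemigroup.interchange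
      (CommutativeMonoid.commutativeSemigroup ℚ.*-1-commutativeMonoid)

  infixr 8 _^_
  _^_ : ℚ → ℕ → ℚ
  _^_ = pow ℚ.+-*-rawSemiring

  0≤^ : ∀ {c} n → 0ℚ ≤ c → 0ℚ ≤ c ^ n
  0≤^ zero    0≤c = ι-mono {0} {1} ℕ.z≤n
  0≤^ {c} (suc n) 0≤c = *-mono-≤ {0ℚ} {c} {0ℚ} {c ^ n} ℚ.≤-refl (0≤^ n 0≤c) 0≤c (0≤^ n 0≤c)

  ^-monoˡ : ∀ {c d} n → 0ℚ ≤ c → c ≤ d → c ^ n ≤ d ^ n
  ^-monoˡ zero    0≤c c≤d = ℚ.≤-refl
  ^-monoˡ (suc n) 0≤c c≤d = *-mono-≤ 0≤c (0≤^ n (ℚ.≤-trans 0≤c c≤d)) c≤d (^-monoˡ n 0≤c c≤d)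

  module _ {c} (1≤c : 1ℚ ≤ c) where

    private
      0≤c : 0ℚ ≤ c
      0≤c = ℚ.≤-trans (0≤ι 1) 1≤c

    ^-step : ∀ n → c ^ n ≤ c ^ suc n
    ^-step n = subst (_≤ c ^ suc n) (ℚ.*-identityˡ (c ^ n)) (*-mono-≤ (0≤ι 1) (0≤^ n 0≤c) 1≤c ℚ.≤-refl)

    1≤^ : ∀ n → 1ℚ ≤ c ^ n
    1≤^ zero    = ℚ.≤-refl
    1≤^ (suc n) = ℚ.≤-trans (1≤^ n) (^-step n)

    ^-monoʳ : ∀ {m n} → m ℕ.≤ n → c ^ m ≤ c ^ n
    ^-monoʳ {n = n} ℕ.z≤n     = 1≤^ n
    ^-monoʳ (ℕ.s≤s {n = n} m≤n) = *-mono-≤ 0≤c (0≤^ n 0≤c) ℚ.≤-refl (^-monoʳ m≤n)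

  ^-distribˡ-+-* : ∀ c m n → c ^ (m ℕ.+ n) ≡ c ^ m * c ^ n
  ^-distribˡ-+-* c zero    n = sym (ℚ.*-identityˡ (c ^ n))
  ^-distribˡ-+-* c (suc m) n =
      trans (cong (c *_) (^-distribˡ-+-* c m n)) (sym (ℚ.*-assoc c (c ^ m) (c ^ n)))

  ι-square : ∀ n → ι (n ℕ.^ 2) ≡ ι n * ι n
  ι-square n = trans (cong (λ z → ι (n ℕ.* z)) (ℕ.*-identityʳ n)) (ι-* n n)

  -- The hypothesis bounds the square of `t`, so the two sides of the goal are compared through
  -- their squares. The exponent, at most `2(n + 1)`, splits into two halves, and `d ≤ 2` turns the
  -- surplus factor `d` of each half into the constant 2.
  root-bound : ∀ {c d t q k n} → 0ℚ ≤ c → c ≤ d → 1ℚ ≤ d → d ≤ ι 2 → k ℕ.≤ suc n ℕ.+ suc n →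
               t ≤ q · c ^⟨ k / 2 ⟩ → ι t ≤ ι (q ℕ.* 2) * d ^ n
  root-bound {c} {d} {t} {q} {k} {n} 0≤c c≤d 1≤d d≤2 k≤ bound = square-cancel-≤ 0≤rhs (begin
    ι t * ι t                                       ≡⟨ ι-square t ⟨
    ι (t ℕ.^ 2)                                     ≤⟨ bound ⟩
    ι (q ℕ.^ 2) * c ^ k                             ≡⟨ cong (_* c ^ k) (ι-square q) ⟩
    ι q * ι q * c ^ k                               ≤⟨ *-mono-≤ 0≤q² 0≤z² ℚ.≤-refl c^k≤ ⟩
    ι q * ι q * ((ι 2 * d ^ n) * (ι 2 * d ^ n))
        ≡⟨ *-interchange (ι q) (ι q) (ι 2 * d ^ n) (ι 2 * d ^ n) ⟩
    (ι q * (ι 2 * d ^ n)) * (ι q * (ι 2 * d ^ n))   ≡⟨ cong (λ z → z * z) regroup ⟩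
    (ι (q ℕ.* 2) * d ^ n) * (ι (q ℕ.* 2) * d ^ n)   ∎)
    where
    open ℚ.≤-Reasoning
    0≤d : 0ℚ ≤ d
    0≤d = ℚ.≤-trans 0≤c c≤d
    0≤prod : ∀ {x y} → 0ℚ ≤ x → 0ℚ ≤ y → 0ℚ ≤ x * y
    0≤prod {x} {y} 0≤x 0≤y = *-mono-≤ {0ℚ} {x} {0ℚ} {y} ℚ.≤-refl 0≤y 0≤x 0≤y
    0≤q² : 0ℚ ≤ ι q * ι q
    0≤q² = 0≤prod (0≤ι q) (0≤ι q)
    0≤z : 0ℚ ≤ ι 2 * d ^ n
    0≤z = 0≤prod (0≤ι 2) (0≤^ n 0≤d)
    0≤z² : 0ℚ ≤ (ι 2 * d ^ n) * (ι 2 * d ^ n)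
    0≤z² = 0≤prod 0≤z 0≤z
    0≤rhs : 0ℚ ≤ ι (q ℕ.* 2) * d ^ n
    0≤rhs = 0≤prod (0≤ι (q ℕ.* 2)) (0≤^ n 0≤d)
    regroup : ι q * (ι 2 * d ^ n) ≡ ι (q ℕ.* 2) * d ^ n
    regroup = trans (sym (ℚ.*-assoc (ι q) (ι 2) (d ^ n))) (cong (_* d ^ n) (sym (ι-* q 2)))
    double : d ^ suc n ≤ ι 2 * d ^ n
    double = *-mono-≤ 0≤d (0≤^ n 0≤d) d≤2 ℚ.≤-refl
    c^k≤ : c ^ k ≤ (ι 2 * d ^ n) * (ι 2 * d ^ n)
    c^k≤ = begin
      c ^ k                            ≤⟨ ^-monoˡ k 0≤c c≤d ⟩
      d ^ k                            ≤⟨ ^-monoʳ 1≤d k≤ ⟩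
      d ^ (suc n ℕ.+ suc n)            ≡⟨ ^-distribˡ-+-* d (suc n) (suc n) ⟩
      d ^ suc n * d ^ suc n            ≤⟨ *-mono-≤ (0≤^ (suc n) 0≤d) 0≤z double double ⟩
      (ι 2 * d ^ n) * (ι 2 * d ^ n)    ∎

  -- Since `d ^ n` is at least 1, the additive overhead `u` can be charged to the coefficient.
  total-bound : ∀ {d T u t q r n} → 1ℚ ≤ d → T ℕ.≤ u ℕ.+ t → u ℕ.+ q ℕ.≤ r → ι t ≤ ι q * d ^ n →
                T ≤ r · d ^⟨ n / 1 ⟩
  total-bound {d} {T} {u} {t} {q} {r} {n} 1≤d T≤ r≥ t≤ = begin
    ι (T ℕ.^ 1)                   ≡⟨ cong ι (ℕ.*-identityʳ T) ⟩
    ι T                           ≤⟨ ι-mono T≤ ⟩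
    ι (u ℕ.+ t)                   ≡⟨ ι-+ u t ⟩
    ι u + ι t                     ≤⟨ ℚ.+-mono-≤ u≤ t≤ ⟩
    ι u * d ^ n + ι q * d ^ n     ≡⟨ ℚ.*-distribʳ-+ (d ^ n) (ι u) (ι q) ⟨
    (ι u + ι q) * d ^ n           ≡⟨ cong (_* d ^ n) (ι-+ u q) ⟨
    ι (u ℕ.+ q) * d ^ n           ≤⟨ *-mono-≤ (0≤ι (u ℕ.+ q)) 0≤y (ι-mono r≥) ℚ.≤-refl ⟩
    ι r * d ^ n                   ≡⟨ cong (λ z → ι z * d ^ n) (ℕ.*-identityʳ r) ⟨
    ι (r ℕ.^ 1) * d ^ n           ∎
    where
    open ℚ.≤-Reasoning
    0≤y : 0ℚ ≤ d ^ n
    0≤y = ℚ.≤-trans (0≤ι 1) (1≤^ 1≤d n)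
    u≤ : ι u ≤ ι u * d ^ n
    u≤ = subst (_≤ ι u * d ^ n) (ℚ.*-identityʳ (ι u)) (*-mono-≤ (0≤ι u) 0≤y ℚ.≤-refl (1≤^ 1≤d n))

  -- At least 1, unlike 2− ε, so its powers increase with the exponent.
  module _ {ε : ℚ} (0<ε : 0ℚ < ε) where

    0<ε⊓1 : 0ℚ < ε ⊓ 1ℚ
    0<ε⊓1 with ℚ.⊓-sel ε 1ℚ
    ... | inj₁ eq = subst (0ℚ <_) (sym eq) 0<ε
    ... | inj₂ eq = subst (0ℚ <_) (sym eq) (ℚ.positive⁻¹ 1ℚ)

    2−-mono : 2− ε ≤ 2− (ε ⊓ 1ℚ)
    2−-mono = ℚ.⊔-monoʳ-≤ 0ℚ (ℚ.+-monoʳ-≤ (ι 2) (ℚ.neg-antimono-≤ (ℚ.p⊓q≤p ε 1ℚ)))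

    1≤2− : 1ℚ ≤ 2− (ε ⊓ 1ℚ)
    1≤2− = ℚ.≤-trans (ℚ.+-monoʳ-≤ (ι 2) (ℚ.neg-antimono-≤ (ℚ.p⊓q≤q ε 1ℚ))) (ℚ.p≤q⊔p 0ℚ _)

    2−≤2 : 2− (ε ⊓ 1ℚ) ≤ ι 2
    2−≤2 = ℚ.⊔-lub (0≤ι 2) (ℚ.+-monoʳ-≤ (ι 2) (ℚ.neg-antimono-≤ (ℚ.<⇒≤ 0<ε⊓1)))

  0≤2− : ∀ ε → 0ℚ ≤ 2− ε
  0≤2− ε = ℚ.p≤p⊔q 0ℚ (ι 2 - ε)

-- Polynomial-time programming in the WHILE language.

module PolynomialTime where

  open import Data.Bool.Base using (Bool; true; false) renaming (if_then_else_ to ifᵇ_then_else_)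
  open import Data.Fin.Base using (Fin; zero; suc)
  open import Data.List.Base using (List; []; _∷_; length; foldl; replicate; map; _++_)
  open import Data.Nat.Base
  open import Data.Nat.GeneralisedArithmetic using (iterate)
  open import Data.Nat.Properties
  open import Data.Product.Base using (∃-syntax; _×_; _,_; proj₁; proj₂)
  open import Data.Unit.Base using (⊤; tt)
  open import Data.Vec.Base using ([]; _∷_)
  open import Function.Base using (id; _∘_; const)
  open import Relation.Binary.PropositionalEquality

  -- Syntax rather than functions, so that monotonicity and monomial bounds follow by induction.
  -- Composition `_⊙_` is a constructor because chained programs produce it.
  data Poly : Set where
    con         : ℕ → Poly
    X           : Poly
    _⊕_ _⊗_ _⊙_ : Poly → Poly → Poly

  infixr 6 _⊕_
  infixr 7 _⊗_
  infixr 8 _⊙_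

  ⟦_⟧ : Poly → ℕ → ℕ
  ⟦ con k ⟧ n = k
  ⟦ X ⟧     n = n
  ⟦ P ⊕ Q ⟧ n = ⟦ P ⟧ n + ⟦ Q ⟧ n
  ⟦ P ⊗ Q ⟧ n = ⟦ P ⟧ n * ⟦ Q ⟧ n
  ⟦ P ⊙ Q ⟧ n = ⟦ P ⟧ (⟦ Q ⟧ n)

  ⟦⟧-mono : ∀ P {m n} → m ≤ n → ⟦ P ⟧ m ≤ ⟦ P ⟧ n
  ⟦⟧-mono (con k) m≤n = ≤-refl
  ⟦⟧-mono X       m≤n = m≤n
  ⟦⟧-mono (P ⊕ Q) m≤n = +-mono-≤ (⟦⟧-mono P m≤n) (⟦⟧-mono Q m≤n)
  ⟦⟧-mono (P ⊗ Q) m≤n = *-mono-≤ (⟦⟧-mono P m≤n) (⟦⟧-mono Q m≤n)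
  ⟦⟧-mono (P ⊙ Q) m≤n = ⟦⟧-mono P (⟦⟧-mono Q m≤n)

  ^-distribʳ-* : ∀ k m n → (m * n) ^ k ≡ m ^ k * n ^ k
  ^-distribʳ-* zero    m n = refl
  ^-distribʳ-* (suc k) m n = begin
    (m * n) * (m * n) ^ k       ≡⟨ cong ((m * n) *_) (^-distribʳ-* k m n) ⟩
    (m * n) * (m ^ k * n ^ k)   ≡⟨ [m*n]*[o*p]≡[m*o]*[n*p] m n (m ^ k) (n ^ k) ⟩
    (m * m ^ k) * (n * n ^ k)   ∎
    where open ≡-Reasoning

  -- Brings a bound into the form `a * n ^ b` that `SolvableInO*` asks for. Positivity of `n` allows
  -- exponents to be raised to a common value.
  monomialBound : ∀ P → ∃[ a ] ∃[ b ] ∀ n .{{_ : NonZero n}} → ⟦ P ⟧ n ≤ a * n ^ b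
  monomialBound (con k) = k , 0 , λ n → ≤-reflexive (sym (*-identityʳ k))
  monomialBound X       = 1 , 1 , λ n →
    ≤-reflexive (sym (trans (*-identityˡ (n * 1)) (*-identityʳ n)))
  monomialBound (P ⊕ Q) with monomialBound P | monomialBound Q
  ... | a , b , p | a′ , b′ , q = a + a′ , b + b′ , λ n → begin
    ⟦ P ⟧ n + ⟦ Q ⟧ n                       ≤⟨ +-mono-≤ (p n) (q n) ⟩
    a * n ^ b + a′ * n ^ b′                 ≤⟨ +-mono-≤ (*-monoʳ-≤ a (^-monoʳ-≤ n (m≤m+n b b′)))
                                                        (*-monoʳ-≤ a′ (^-monoʳ-≤ n (m≤n+m b′ b))) ⟩
    a * n ^ (b + b′) + a′ * n ^ (b + b′)    ≡⟨ *-distribʳ-+ (n ^ (b + b′)) a a′ ⟨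
    (a + a′) * n ^ (b + b′)                 ∎
    where open ≤-Reasoning
  monomialBound (P ⊗ Q) with monomialBound P | monomialBound Q
  ... | a , b , p | a′ , b′ , q = a * a′ , b + b′ , λ n → begin
    ⟦ P ⟧ n * ⟦ Q ⟧ n              ≤⟨ *-mono-≤ (p n) (q n) ⟩
    (a * n ^ b) * (a′ * n ^ b′)    ≡⟨ [m*n]*[o*p]≡[m*o]*[n*p] a (n ^ b) a′ (n ^ b′) ⟩
    (a * a′) * (n ^ b * n ^ b′)    ≡⟨ cong (a * a′ *_) (^-distribˡ-+-* n b b′) ⟨
    (a * a′) * n ^ (b + b′)        ∎
    where open ≤-Reasoning
  monomialBound (P ⊙ Q) with monomialBound P | monomialBound Q
  -- `suc a′` in place of `a′`: the bound for `P` applies at positive arguments only, and `a′` may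
  -- be 0.
  ... | a , b , p | a′ , b′ , q = a * suc a′ ^ b , b′ * b , λ n →
    let instance n^≢0 = m^n≢0 n b′
                 prod≢0 = m*n≢0 (suc a′) (n ^ b′)
    in begin
    ⟦ P ⟧ (⟦ Q ⟧ n)                ≤⟨ ⟦⟧-mono P (q n) ⟩
    ⟦ P ⟧ (a′ * n ^ b′)            ≤⟨ ⟦⟧-mono P (*-monoˡ-≤ (n ^ b′) (n≤1+n a′)) ⟩
    ⟦ P ⟧ (suc a′ * n ^ b′)        ≤⟨ p (suc a′ * n ^ b′) ⟩
    a * (suc a′ * n ^ b′) ^ b      ≡⟨ cong (a *_) (^-distribʳ-* b (suc a′) (n ^ b′)) ⟩
    a * (suc a′ ^ b * (n ^ b′) ^ b) ≡⟨ cong (λ z → a * (suc a′ ^ b * z)) (^-*-assoc n b′ b) ⟩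
    a * (suc a′ ^ b * n ^ (b′ * b)) ≡⟨ *-assoc a (suc a′ ^ b) (n ^ (b′ * b)) ⟨
    a * suc a′ ^ b * n ^ (b′ * b)  ∎
    where open ≤-Reasoning

  size≥1 : ∀ t → 1 ≤ size t
  size≥1 nil     = ≤-refl
  size≥1 (s ∙ t) = s≤s z≤n

  -- Calling convention: `v₀` carries argument and result, `v₁` is a stack that must be restored,
  -- the rest of the store stays untouched. Being uniform in `m`, the code can run beside any number
  -- of foreign variables. `grow` bounds output sizes, on which the time of the next program is
  -- measured.
  record PolyTime {A B : Set} (eA : A → Tree) (eB : B → Tree) (f : A → B) : Set where
    field
      code      : ∀ {m} → Cmd (2 + m)
      time grow : Poly
      runs      : ∀ {m} a s (ρ : Store m) →
        ∃[ t ] ⟨ code , eA a ∷ s ∷ ρ ⟩⇓⟨ eB (f a) ∷ s ∷ ρ , t ⟩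
             × t ≤ ⟦ time ⟧ (size (eA a))
      grows     : ∀ a → size (eB (f a)) ≤ ⟦ grow ⟧ (size (eA a))

  open PolyTime

  v₀ v₁ : ∀ {m} → Fin (2 + m)
  v₀ = zero
  v₁ = suc zero

  x₀ x₁ : ∀ {m} → Expr (2 + m)
  x₀ = var v₀
  x₁ = var v₁

  module _ {A B : Set} {eA : A → Tree} {eB : B → Tree} where

    ext : ∀ {f g : A → B} → (∀ a → f a ≡ g a) → PolyTime eA eB f → PolyTime eA eB g
    ext f≗g F = record
      { code  = code F
      ; time  = time F
      ; grow  = grow F
      ; runs  = λ a s ρ → subst (λ b → ∃[ t ] ⟨ code F , eA a ∷ s ∷ ρ ⟩⇓⟨ eB b ∷ s ∷ ρ , t ⟩
                                              × t ≤ ⟦ time F ⟧ (size (eA a))) (f≗g a) (runs F a s ρ)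
      ; grows = λ a → subst (λ b → size (eB b) ≤ ⟦ grow F ⟧ (size (eA a))) (f≗g a) (grows F a)
      }

    recode : ∀ {A′ : Set} {eA′ : A′ → Tree} {f : A → B} (h : A′ → A) → (∀ a → eA′ a ≡ eA (h a)) →
             PolyTime eA eB f → PolyTime eA′ eB (f ∘ h)
    recode {eA′ = eA′} {f} h eq F = record
      { code  = code F
      ; time  = time F
      ; grow  = grow F
      ; runs  = λ a s ρ → subst (λ x → ∃[ t ] ⟨ code F , x ∷ s ∷ ρ ⟩⇓⟨ eB (f (h a)) ∷ s ∷ ρ , t ⟩
                                              × t ≤ ⟦ time F ⟧ (size x)) (sym (eq a)) (runs F (h a) s ρ)
      ; grows = λ a → subst (λ x → size (eB (f (h a))) ≤ ⟦ grow F ⟧ (size x)) (sym (eq a))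
          (grows F (h a))
      }

    constant : (b : B) → eB b ≡ nil → PolyTime eA eB (const b)
    constant b eq = record
      { code  = v₀ := nil
      ; time  = con 2
      ; grow  = con 1
      ; runs  = λ a s ρ → 2 , subst (λ y → ⟨ v₀ := nil , eA a ∷ s ∷ ρ ⟩⇓⟨ y ∷ s ∷ ρ , 2 ⟩)
                                (sym eq) assign , ≤-refl
      ; grows = λ a → ≤-reflexive (cong size eq)
      }

  identity : ∀ {A : Set} {eA : A → Tree} → PolyTime eA eA id
  identity = record
    { code  = v₀ := x₀
    ; time  = con 2
    ; grow  = X
    ; runs  = λ a s ρ → 2 , assign , ≤-refl
    ; grows = λ a → ≤-refl
    }

  infixr 9 _⊚_

  _⊚_ : ∀ {A B C : Set} {eA : A → Tree} {eB : B → Tree} {eC : C → Tree} {g : B → C} {f : A → B} →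
        PolyTime eB eC g → PolyTime eA eB f → PolyTime eA eC (g ∘ f)
  _⊚_ {f = f} G F = record
    { code  = code F ⨾ code G
    ; time  = time F ⊕ time G ⊙ grow F
    ; grow  = grow G ⊙ grow F
    ; runs  = λ a s ρ → let t , F⇓ , t≤ = runs F a s ρ
                            u , G⇓ , u≤ = runs G (f a) s ρ
                        in t + u , seq F⇓ G⇓ ,
                           +-mono-≤ t≤ (≤-trans u≤ (⟦⟧-mono (time G) (grows F a)))
    ; grows = λ a → ≤-trans (grows G (f a)) (⟦⟧-mono (grow G) (grows F a))
    }

  module _ {A B : Set} {eA : A → Tree} {eB : B → Tree} where

    first : PolyTime (encodePair eA eB) eA proj₁
    first = record
      { code  = v₀ := hd x₀
      ; time  = con 3
      ; grow  = X
      ; runs  = λ a s ρ → 3 , assign , ≤-refl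
      ; grows = λ (a , b) → m≤n⇒m≤1+n (m≤m+n _ _)
      }

    second : PolyTime (encodePair eA eB) eB proj₂
    second = record
      { code  = v₀ := tl x₀
      ; time  = con 3
      ; grow  = X
      ; runs  = λ a s ρ → 3 , assign , ≤-refl
      ; grows = λ (a , b) → m≤n⇒m≤1+n (m≤n+m _ (size (eA a)))
      }

  pair : ∀ {A B C : Set} {eA : A → Tree} {eB : B → Tree} {eC : C → Tree} {f : A → B} {g : A → C} →
         PolyTime eA eB f → PolyTime eA eC g → PolyTime eA (encodePair eB eC) (λ a → f a , g a)
  pair {eA = eA} {eB} {f = f} F G = record
    -- A copy of the argument is pushed before `F` runs. Its result is then exchanged with the saved
    -- argument through a tree holding both, as there is no third register. The constants 4, 15 and
    -- 8 below are the costs of the assignments before, between and after the two calls.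
    { code  = v₁ := cons x₀ x₁ ⨾
              code F ⨾
              v₀ := cons x₀ x₁ ⨾ v₁ := cons (hd x₀) (tl (tl x₀)) ⨾ v₀ := hd (tl x₀) ⨾
              code G ⨾
              v₀ := cons (hd x₁) x₀ ⨾ v₁ := tl x₁
    ; time  = con 4 ⊕ time F ⊕ con 15 ⊕ time G ⊕ con 8
    ; grow  = con 1 ⊕ grow F ⊕ grow G
    ; runs  = λ a s ρ → let t , F⇓ , t≤ = runs F a (eA a ∙ s) ρ
                            u , G⇓ , u≤ = runs G a (eB (f a) ∙ s) ρ
                        in _ , seq assign (seq F⇓ (seq assign (seq assign (seq assign
                                 (seq G⇓ (seq assign assign)))))) ,
                           +-monoʳ-≤ 4 (+-mono-≤ t≤ (+-monoʳ-≤ 15 (+-monoˡ-≤ 8 u≤)))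
    ; grows = λ a → s≤s (+-mono-≤ (grows F a) (grows G a))
    }

  cond : ∀ {A B : Set} {eA : A → Tree} {eB : B → Tree} {f g : A → B} {c : A → Bool} →
         PolyTime eA encodeBool c → PolyTime eA eB f → PolyTime eA eB g →
         PolyTime eA eB (λ a → ifᵇ c a then f a else g a)
  cond {A} {eA = eA} {eB} {f} {g} {c} C F G = record
    -- The test alone would overwrite `v₀`, so its result is computed together with a copy of the
    -- argument.
    { code  = code P ⨾ if hd x₀ then (v₀ := tl x₀ ⨾ code F) else (v₀ := tl x₀ ⨾ code G)
    ; time  = time P ⊕ con 6 ⊕ (time F ⊕ time G)
    ; grow  = grow F ⊕ grow G
    ; runs  = λ a s ρ → let t , P⇓ , t≤ = runs P a s ρ
                            u , B⇓ , u≤ = branch a (c a) s ρ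
                        in t + u , seq P⇓ B⇓ , +-mono-≤ t≤ u≤
    ; grows = λ a → grows′ a (c a)
    }
    where
    P : PolyTime eA (encodePair encodeBool eA) (λ a → c a , a)
    P = pair C identity

    branch : ∀ {m} a b s (ρ : Store m) →
      ∃[ t ] ⟨ if hd x₀ then (v₀ := tl x₀ ⨾ code F) else (v₀ := tl x₀ ⨾ code G) ,
               (encodeBool b ∙ eA a) ∷ s ∷ ρ ⟩⇓⟨ eB (ifᵇ b then f a else g a) ∷ s ∷ ρ , t ⟩
           × t ≤ 6 + (⟦ time F ⟧ (size (eA a)) + ⟦ time G ⟧ (size (eA a)))
    branch a true  s ρ = let t , F⇓ , t≤ = runs F a s ρ in
      _ , if-true (λ ()) (seq assign F⇓) , +-monoʳ-≤ 6 (m≤n⇒m≤n+o _ t≤)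
    branch a false s ρ = let t , G⇓ , t≤ = runs G a s ρ in
      _ , if-false refl (seq assign G⇓) , +-monoʳ-≤ 6 (m≤n⇒m≤o+n _ t≤)

    grows′ : ∀ a b → size (eB (ifᵇ b then f a else g a)) ≤
                     ⟦ grow F ⟧ (size (eA a)) + ⟦ grow G ⟧ (size (eA a))
    grows′ a true  = m≤n⇒m≤n+o _ (grows F a)
    grows′ a false = m≤n⇒m≤o+n _ (grows G a)

  isZero : ℕ → Bool
  isZero n = n ≡ᵇ 0

  isZeroᴾ : PolyTime encodeℕ encodeBool isZero
  isZeroᴾ = record
    { code  = if x₀ then (v₀ := nil) else (v₀ := cons nil nil)
    ; time  = con 6
    ; grow  = con 3
    ; runs  = λ where
        zero    s ρ → 6 , if-false refl assign , ≤-refl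
        (suc n) s ρ → 4 , if-true (λ ()) assign , m≤m+n 4 2
    ; grows = λ where
        zero    → ≤-refl
        (suc n) → s≤s z≤n
    }

  sucᴾ : PolyTime encodeℕ encodeℕ suc
  sucᴾ = record
    { code  = v₀ := cons nil x₀
    ; time  = con 4
    ; grow  = con 2 ⊕ X
    ; runs  = λ a s ρ → 4 , assign , ≤-refl
    ; grows = λ a → ≤-refl
    }

  predᴾ : PolyTime encodeℕ encodeℕ pred
  predᴾ = record
    { code  = v₀ := tl x₀
    ; time  = con 3
    ; grow  = X
    ; runs  = λ where
        zero    s ρ → 3 , assign , ≤-refl
        (suc n) s ρ → 3 , assign , ≤-refl
    ; grows = λ where
        zero    → ≤-refl
        (suc n) → m≤n+m _ 2
    }

  prepend : ∀ {A : Set} {eA : A → Tree} →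
            PolyTime (encodePair eA (encodeList eA)) (encodeList eA) (λ (x , xs) → x ∷ xs)
  prepend = record
    { code  = v₀ := x₀
    ; time  = con 2
    ; grow  = X
    ; runs  = λ a s ρ → 2 , assign , ≤-refl
    ; grows = λ a → ≤-refl
    }

  size-element : ∀ {A : Set} {eA : A → Tree} x xs → size (eA x) ≤ size (encodeList eA (x ∷ xs))
  size-element x xs = m≤n⇒m≤1+n (m≤m+n _ _)

  size-rest : ∀ {A : Set} {eA : A → Tree} x xs →
              size (encodeList eA xs) ≤ size (encodeList eA (x ∷ xs))
  size-rest {eA = eA} x xs = m≤n⇒m≤1+n (m≤n+m _ (size (eA x)))

  length≤size : ∀ {A : Set} {eA : A → Tree} xs → length xs ≤ size (encodeList eA xs)
  length≤size []       = z≤n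
  length≤size {eA = eA} (x ∷ xs) = s≤s (≤-trans (length≤size xs) (m≤n+m _ (size (eA x))))

  -- Folding preserves polynomial time if the state grows additively. The
  -- increment may depend on a part of the state, of size w, that itself grows
  -- by an increment depending only on the list elements.

  module Fold {A S : Set} {eA : A → Tree} {eS : S → Tree} {g : A × S → S}
              (G : PolyTime (encodePair eA eS) eS g)
              (w : S → ℕ) (w≤size : ∀ s → w s ≤ size (eS s)) (D C : Poly)
              (w-grows : ∀ x s → w (g (x , s)) ≤ ⟦ D ⟧ (size (eA x)) + w s)
              (g-grows : ∀ x s → size (eS (g (x , s))) ≤ ⟦ C ⟧ (size (eA x) + w s) + size (eS s))
              where

    fold : List A → S → S
    fold xs s = foldl (λ s x → g (x , s)) s xs

    increment : Poly
    increment = X ⊗ C ⊙ (X ⊕ (X ⊗ D ⊕ X))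

    private
      W : Poly
      W = X ⊗ D ⊕ X

      loop : ∀ {m} → Cmd (2 + m)
      loop = while hd x₀ repeat
        (v₁ := cons (tl (hd x₀)) x₁ ⨾ v₀ := cons (hd (hd x₀)) (tl x₀) ⨾
         code G ⨾
         v₀ := cons (hd x₁) x₀ ⨾ v₁ := tl x₁)

      module _ (N M : ℕ) where

        step : ℕ
        -- 16 machine steps before `G` and 8 after it; the pair `(x , s)` has size at most
        -- `suc (N + M)`.
        step = 24 + ⟦ time G ⟧ (suc (N + M))

        -- A potential: the number of steps to come times the largest increment, plus the current
        -- size. It never increases along the loop, so its initial value bounds every intermediate
        -- state. `N` bounds the list, `⟦ W ⟧ N` the measure `w`, and `M` the state.
        Bounded : List A → S → Set
        Bounded xs s = size (encodeList eA xs) ≤ N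
                     × length xs * ⟦ D ⟧ N + w s ≤ ⟦ W ⟧ N
                     × length xs * ⟦ C ⟧ (N + ⟦ W ⟧ N) + size (eS s) ≤ M

        bounded-step : ∀ {x xs s} → Bounded (x ∷ xs) s → Bounded xs (g (x , s))
        bounded-step {x} {xs} {s} (n , p , q) =
            ≤-trans (size-rest x xs) n
          , (begin
              l * ⟦ D ⟧ N + w (g (x , s))              ≤⟨ +-monoʳ-≤ (l * ⟦ D ⟧ N) (w-grows x s) ⟩
              l * ⟦ D ⟧ N + (⟦ D ⟧ (size (eA x)) + w s)
                  ≤⟨ +-monoʳ-≤ (l * ⟦ D ⟧ N) (+-monoˡ-≤ (w s) (⟦⟧-mono D x≤N)) ⟩
              l * ⟦ D ⟧ N + (⟦ D ⟧ N + w s)            ≡⟨ swap (l * ⟦ D ⟧ N) (⟦ D ⟧ N) (w s) ⟩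
              suc l * ⟦ D ⟧ N + w s                    ≤⟨ p ⟩
              ⟦ W ⟧ N                                  ∎)
          , (begin
              l * c + size (eS (g (x , s)))            ≤⟨ +-monoʳ-≤ (l * c) (g-grows x s) ⟩
              l * c + (⟦ C ⟧ (size (eA x) + w s) + size (eS s))
                  ≤⟨ +-monoʳ-≤ (l * c) (+-monoˡ-≤ (size (eS s)) (⟦⟧-mono C
                                                            (+-mono-≤ x≤N (m+n≤o⇒n≤o
                                                                (suc l * ⟦ D ⟧ N) p)))) ⟩
              l * c + (c + size (eS s))                ≡⟨ swap (l * c) c (size (eS s)) ⟩
              suc l * c + size (eS s)                  ≤⟨ q ⟩
              M                                  ∎)
          where
          open ≤-Reasoning
          l = length xs
          c = ⟦ C ⟧ (N + ⟦ W ⟧ N)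
          x≤N : size (eA x) ≤ N
          x≤N = ≤-trans (size-element {eA = eA} x xs) n
          swap : ∀ a b c → a + (b + c) ≡ b + a + c
          swap a b c = trans (sym (+-assoc a b c)) (cong (_+ c) (+-comm a b))

        loop-runs : ∀ {m} xs s → Bounded xs s → ∀ r (ρ : Store m) →
          ∃[ t ] ⟨ loop , (encodeList eA xs ∙ eS s) ∷ r ∷ ρ ⟩⇓⟨ (nil ∙ eS (fold xs s)) ∷ r ∷ ρ , t ⟩
               × t ≤ length xs * step + 3
        loop-runs []       s b r ρ = 3 , while-false refl , ≤-refl
        loop-runs (x ∷ xs) s b@(n , _ , q) r ρ =
          let t , G⇓ , t≤ = runs G (x , s) (encodeList eA xs ∙ r) ρ
              u , L⇓ , u≤ = loop-runs xs (g (x , s)) (bounded-step b) r ρ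
          in _ , while-true (λ ()) (seq assign (seq assign (seq G⇓ (seq assign assign)))) L⇓ , (begin
            16 + (t + 8 + u)                     ≤⟨ +-monoʳ-≤ 16 (+-mono-≤ (+-monoˡ-≤ 8 (≤-trans t≤
                                                      (⟦⟧-mono (time G) (s≤s (+-mono-≤
                                                          (≤-trans (size-element {eA = eA} x xs) n)
                                                        (m+n≤o⇒n≤o (length (x ∷ xs) * ⟦ C ⟧
                                                            (N + ⟦ W ⟧ N)) q)))))) u≤) ⟩
            16 + (τ + 8 + (length xs * step + 3))
                ≡⟨ cong (λ z → 16 + (z + (length xs * step + 3))) (+-comm τ 8) ⟩
            step + (length xs * step + 3)        ≡⟨ +-assoc step (length xs * step) 3 ⟨
            step + length xs * step + 3          ∎)
          where
          open ≤-Reasoning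
          τ = ⟦ time G ⟧ (suc (N + M))

        fold-bounded : ∀ xs s → Bounded xs s → size (eS (fold xs s)) ≤ M
        fold-bounded []       s (_ , _ , q) = q
        fold-bounded (x ∷ xs) s b           = fold-bounded xs (g (x , s)) (bounded-step b)

      initially : ∀ xs s → let N = size (encodeList eA xs) + w s in
                  Bounded N (⟦ increment ⟧ N + size (eS s)) xs s
      initially xs s = xs≤ , +-mono-≤ (*-monoˡ-≤ (⟦ D ⟧ N) l≤) (m≤n+m _ (size (encodeList eA xs))) ,
                       +-monoˡ-≤ (size (eS s)) (*-monoˡ-≤ (⟦ C ⟧ (N + ⟦ W ⟧ N)) l≤)
        where
        N = size (encodeList eA xs) + w s
        xs≤ : size (encodeList eA xs) ≤ N
        xs≤ = m≤m+n _ _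
        l≤ : length xs ≤ N
        l≤ = ≤-trans (length≤size xs) xs≤

    fold-grows : ∀ xs s →
      size (eS (fold xs s)) ≤ ⟦ increment ⟧ (size (encodeList eA xs) + w s) + size (eS s)
    fold-grows xs s = fold-bounded _ _ xs s (initially xs s)

    foldᴾ : PolyTime (encodePair (encodeList eA) eS) eS (λ (xs , s) → fold xs s)
    foldᴾ = record
      { code  = loop ⨾ v₀ := tl x₀
      ; time  = X ⊗ (con 24 ⊕ time G ⊙ (con 1 ⊕ (X ⊕ (increment ⊕ X)))) ⊕ con 6
      ; grow  = increment ⊕ X
      ; runs  = λ (xs , s) r ρ →
          let N = size (encodeList eA xs) + w s
              M = ⟦ increment ⟧ N + size (eS s)
              N′ = size (encodePair (encodeList eA) eS (xs , s))
              N≤ , M≤ = bounds xs s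
              t , L⇓ , t≤ = loop-runs N M xs s (initially xs s) r ρ
          in t + 3 , seq L⇓ assign , (begin
            t + 3                                   ≤⟨ +-monoˡ-≤ 3 t≤ ⟩
            length xs * step N M + 3 + 3            ≡⟨ +-assoc (length xs * step N M) 3 3 ⟩
            length xs * step N M + 6                ≤⟨ +-monoˡ-≤ 6 (*-mono-≤
                                                         (≤-trans (≤-trans (length≤size xs)
                                                             (m≤m+n _ _)) N≤)
                                                         (+-monoʳ-≤ 24 (⟦⟧-mono (time G)
                                                             (s≤s (+-mono-≤ N≤ M≤))))) ⟩
            N′ * (24 + ⟦ time G ⟧ (suc (N′ + (⟦ increment ⟧ N′ + N′)))) + 6 ∎)
      ; grows = λ (xs , s) → ≤-trans (fold-grows xs s) (proj₂ (bounds xs s))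
      }
      where
      open ≤-Reasoning
      bounds : ∀ xs s → let N  = size (encodeList eA xs) + w s
                            N′ = size (encodePair (encodeList eA) eS (xs , s)) in
               N ≤ N′ × ⟦ increment ⟧ N + size (eS s) ≤ ⟦ increment ⟧ N′ + N′
      bounds xs s = N≤N′ , +-mono-≤ (⟦⟧-mono increment N≤N′)
                             (m≤n⇒m≤1+n (m≤n+m _ (size (encodeList eA xs))))
        where N≤N′ = m≤n⇒m≤1+n (+-monoʳ-≤ (size (encodeList eA xs)) (w≤size s))

  encodeUnit : ⊤ → Tree
  encodeUnit _ = nil

  encodeℕ≡encodeList : ∀ n → encodeℕ n ≡ encodeList encodeUnit (replicate n tt)
  encodeℕ≡encodeList zero    = refl
  encodeℕ≡encodeList (suc n) = cong (nil ∙_) (encodeℕ≡encodeList n)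

  -- A unary number is the same tree as a list of that many units, so iteration is a fold whose step
  -- ignores the list element.
  module Iterate {S : Set} {eS : S → Tree} {g : S → S} (G : PolyTime eS eS g)
                 (w : S → ℕ) (w≤size : ∀ s → w s ≤ size (eS s)) (d : ℕ) (C : Poly)
                 (w-grows : ∀ s → w (g s) ≤ d + w s)
                 (g-grows : ∀ s → size (eS (g s)) ≤ ⟦ C ⟧ (w s) + size (eS s))
                 where

    private
      module F = Fold {eA = encodeUnit} (G ⊚ second) w w≤size (con d) C
                   (λ _ s → w-grows s)
                   (λ _ s → ≤-trans (g-grows s) (+-monoˡ-≤ (size (eS s)) (⟦⟧-mono C (n≤1+n (w s)))))

      fold≡iterate : ∀ n s → F.fold (replicate n tt) s ≡ iterate g s n
      fold≡iterate zero    s = refl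
      fold≡iterate (suc n) s = fold≡iterate n (g s)

    iterateᴾ : PolyTime (encodePair encodeℕ eS) eS (λ (n , s) → iterate g s n)
    iterateᴾ = ext (λ (n , s) → fold≡iterate n s)
      (recode (λ (n , s) → replicate n tt , s)
          (λ (n , s) → cong (_∙ eS s) (encodeℕ≡encodeList n)) F.foldᴾ)

  -- The reduction on raw data, together with its code.

  Edge : Set
  Edge = ℕ × ℕ

  encodeEdges : List Edge → Tree
  encodeEdges = encodeList (encodePair encodeℕ encodeℕ)

  -- The vertices numbered from 0 up to the first component are in use.
  Partial : Set
  Partial = ℕ × List Edge

  encodePartial : Partial → Tree
  encodePartial = encodePair encodeℕ encodeEdges

  -- Each pair of variables has 12 vertices, here numbered relative to the first
  -- of them: 0 and 1 are the literals of the first variable, 6 and 7 those of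
  -- the second.
  gadget : List Edge
  gadget = (0 , 2) ∷ (1 , 2) ∷ (0 , 3) ∷ (1 , 3) ∷ (6 , 8) ∷ (7 , 8) ∷ (6 , 9) ∷ (7 , 9) ∷
           (0 , 4) ∷ (6 , 4) ∷ (0 , 5) ∷ (7 , 5) ∷ (1 , 10) ∷ (6 , 10) ∷ (1 , 11) ∷ (7 , 11) ∷ []

  shift : ℕ → Edge → Edge
  shift b (p , q) = p + b , q + b

  addGadget : Partial → Partial
  addGadget (b , es) = 12 + b , map (shift b) gadget ++ es

  -- With 12 vertices per pair of variables and literals at slots 0 and 6, variable `i` begins at
  -- vertex `6 * i` whatever its parity.
  literal : Bool × ℕ → ℕ
  literal (s , i) = ifᵇ s then i * 6 else suc (i * 6)

  addLiteral : (Bool × ℕ) × Partial → Partial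
  addLiteral (l , (c , es)) = c , (literal l , c) ∷ es

  addClause : List (Bool × ℕ) × Partial → Partial
  addClause (ls , st) = let (c , es) = foldl (λ s l → addLiteral (l , s)) st ls in suc c , es

  RawCNF : Set
  RawCNF = ℕ × List (List (Bool × ℕ))

  encodeRawCNF : RawCNF → Tree
  encodeRawCNF = encodePair encodeℕ (encodeList (encodeList (encodePair encodeBool encodeℕ)))

  reduction : RawCNF → Partial
  reduction (n , cs) = foldl (λ s c → addClause (c , s)) (iterate addGadget (0 , []) ⌈ n /2⌉) cs

  plusᴾ : ∀ k → PolyTime encodeℕ encodeℕ (k +_)
  plusᴾ zero    = identity
  plusᴾ (suc k) = sucᴾ ⊚ plusᴾ k

  timesᴾ : ∀ k → PolyTime encodeℕ encodeℕ (_* k)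
  timesᴾ k = ext (λ n → trans (iterate-plus n 0) (+-identityʳ (n * k)))
    (I.iterateᴾ ⊚ pair identity (constant 0 refl))
    where
    size-plus : ∀ k n → size (encodeℕ (k + n)) ≤ 2 * k + size (encodeℕ n)
    size-plus zero    n = ≤-refl
    size-plus (suc k) n = begin
      2 + size (encodeℕ (k + n))        ≤⟨ +-monoʳ-≤ 2 (size-plus k n) ⟩
      2 + (2 * k + size (encodeℕ n))    ≡⟨ cong (_+ size (encodeℕ n)) (*-suc 2 k) ⟨
      2 * suc k + size (encodeℕ n)      ∎
      where open ≤-Reasoning

    module I = Iterate (plusᴾ k) (const 0) (λ _ → z≤n) 0 (con (2 * k)) (λ _ → z≤n) (size-plus k)

    iterate-plus : ∀ n s → iterate (k +_) s n ≡ n * k + s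
    iterate-plus zero    s = refl
    iterate-plus (suc n) s = begin
      iterate (k +_) (k + s) n  ≡⟨ iterate-plus n (k + s) ⟩
      n * k + (k + s)           ≡⟨ +-assoc (n * k) k s ⟨
      n * k + k + s             ≡⟨ cong (_+ s) (+-comm (n * k) k) ⟩
      suc n * k + s             ∎
      where open ≡-Reasoning

  halfᴾ : PolyTime encodeℕ encodeℕ ⌈_/2⌉
  halfᴾ = ext (λ n → trans (cong proj₁ (halves n 0)) (cong ⌈_/2⌉ (+-identityʳ n)))
    (first ⊚ I.iterateᴾ ⊚ pair identity (pair (constant 0 refl) (constant 0 refl)))
    where
    -- Passing from `k` to `k + 1` takes `(⌈ k /2⌉ , ⌊ k /2⌋)` to `(1 + ⌊ k /2⌋ , ⌈ k /2⌉)`, so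
    -- halving only takes a swap and a successor.
    next : ℕ × ℕ → ℕ × ℕ
    next (a , b) = suc b , a

    module I = Iterate {eS = encodePair encodeℕ encodeℕ} {g = next} (pair (sucᴾ ⊚ second) first)
      (const 0) (λ _ → z≤n) 0 (con 2) (λ _ → z≤n)
      (λ (a , b) → +-monoʳ-≤ 3 (≤-reflexive (+-comm (size (encodeℕ b)) (size (encodeℕ a)))))

    halves : ∀ n k → iterate next (⌈ k /2⌉ , ⌊ k /2⌋) n ≡ (⌈ n + k /2⌉ , ⌊ n + k /2⌋)
    halves zero    k = refl
    halves (suc n) k = trans (halves n (suc k)) (cong (λ m → ⌈ m /2⌉ , ⌊ m /2⌋) (+-suc n k))

  -- New edges depend on the vertex counter but not on earlier edges. Measuring the counter alone
  -- therefore keeps increments additive; including the edge list would let them compound.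
  width : Partial → ℕ
  width (c , es) = size (encodeℕ c)

  width≤size : ∀ st → width st ≤ size (encodePartial st)
  width≤size (c , es) = m≤n⇒m≤1+n (m≤m+n _ _)

  gadgetᴾ : ∀ ls → PolyTime encodePartial encodeEdges (λ (b , es) → map (shift b) ls ++ es)
  gadgetᴾ []             = second
  gadgetᴾ ((p , q) ∷ ls) =
    prepend ⊚ pair (pair (plusᴾ p ⊚ first) (plusᴾ q ⊚ first)) (gadgetᴾ ls)

  gadget-growth : List Edge → Poly
  gadget-growth []             = con 0
  gadget-growth ((p , q) ∷ ls) = con 2 ⊕ (grow (plusᴾ p) ⊕ grow (plusᴾ q)) ⊕ gadget-growth ls

  gadget-grows : ∀ ls b es → size (encodeEdges (map (shift b) ls ++ es)) ≤
                             ⟦ gadget-growth ls ⟧ (size (encodeℕ b)) + size (encodeEdges es)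
  gadget-grows []             b es = ≤-refl
  gadget-grows ((p , q) ∷ ls) b es = s≤s (s≤s (begin
    size (encodeℕ (p + b)) + size (encodeℕ (q + b)) + size (encodeEdges (map (shift b) ls ++ es))
      ≤⟨ +-mono-≤ (+-mono-≤ (grows (plusᴾ p) b) (grows (plusᴾ q) b)) (gadget-grows ls b es) ⟩
    E + (⟦ gadget-growth ls ⟧ w + size (encodeEdges es))
      ≡⟨ +-assoc E _ _ ⟨
    E + ⟦ gadget-growth ls ⟧ w + size (encodeEdges es) ∎))
    where
    open ≤-Reasoning
    w = size (encodeℕ b)
    E = ⟦ grow (plusᴾ p) ⟧ w + ⟦ grow (plusᴾ q) ⟧ w

  addGadgetᴾ : PolyTime encodePartial encodePartial addGadget
  addGadgetᴾ = pair (plusᴾ 12 ⊚ first) (gadgetᴾ gadget)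

  addGadgetsᴾ : PolyTime (encodePair encodeℕ encodePartial) encodePartial
                         (λ (n , st) → iterate addGadget st n)
  addGadgetsᴾ = Iterate.iterateᴾ addGadgetᴾ width width≤size 24 (con 24 ⊕ gadget-growth gadget)
    (λ st → ≤-refl) (λ (b , es) → grows′ b es)
    where
    open ≤-Reasoning
    grows′ : ∀ b es → size (encodePartial (addGadget (b , es))) ≤
                      24 + ⟦ gadget-growth gadget ⟧ (size (encodeℕ b)) + size (encodePartial (b , es))
    grows′ b es = begin
      suc (24 + w + size (encodeEdges (map (shift b) gadget ++ es)))
        ≤⟨ +-monoʳ-≤ (25 + w) (gadget-grows gadget b es) ⟩
      25 + w + (γ + e)      ≡⟨ cong (25 +_) (+-assoc w γ e) ⟨
      25 + (w + γ + e)      ≡⟨ cong (λ z → 25 + (z + e)) (+-comm w γ) ⟩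
      25 + (γ + w + e)      ≡⟨ cong (25 +_) (+-assoc γ w e) ⟩
      25 + (γ + (w + e))    ≡⟨ cong (24 +_) (+-suc γ (w + e)) ⟨
      24 + (γ + suc (w + e)) ∎
      where
      w = size (encodeℕ b)
      e = size (encodeEdges es)
      γ = ⟦ gadget-growth gadget ⟧ w

  literalᴾ : PolyTime (encodePair encodeBool encodeℕ) encodeℕ literal
  literalᴾ = cond first (timesᴾ 6 ⊚ second) (sucᴾ ⊚ timesᴾ 6 ⊚ second)

  addLiteralᴾ : PolyTime
      (encodePair (encodePair encodeBool encodeℕ) encodePartial) encodePartial addLiteral
  addLiteralᴾ = pair (first ⊚ second)
      (prepend ⊚ pair (pair (literalᴾ ⊚ first) (first ⊚ second)) (second ⊚ second))

  addLiteral-grows : ∀ l c es → let x = size (encodePair encodeBool encodeℕ l) + size (encodeℕ c) in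
    size (encodePartial (addLiteral (l , (c , es)))) ≤
    2 + (⟦ grow literalᴾ ⟧ x + x) + size (encodePartial (c , es))
  addLiteral-grows l c es = begin
    suc (w + (suc (suc (v + w) + e)))   ≡⟨ cong suc (+-suc w (suc (v + w + e))) ⟩
    2 + (w + suc (v + w + e))           ≡⟨ cong (2 +_) (+-suc w (v + w + e)) ⟩
    3 + (w + (v + w + e))               ≡⟨ cong (3 +_) (+-assoc w (v + w) e) ⟨
    3 + (w + (v + w) + e)               ≡⟨ cong (λ z → 3 + (z + e)) (+-comm w (v + w)) ⟩
    3 + (v + w + w + e)                 ≡⟨ cong (3 +_) (+-assoc (v + w) w e) ⟩
    3 + (v + w + (w + e))               ≡⟨ cong (2 +_) (+-suc (v + w) (w + e)) ⟨
    2 + (v + w + suc (w + e))           ≤⟨ +-monoʳ-≤ 2 (+-monoˡ-≤ _ (+-mono-≤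
                                             (≤-trans (grows literalᴾ l)
                                                 (⟦⟧-mono (grow literalᴾ) (m≤m+n x w)))
                                             (m≤n+m w x))) ⟩
    2 + (⟦ grow literalᴾ ⟧ (x + w) + (x + w) + suc (w + e)) ∎
    where
    open ≤-Reasoning
    x = size (encodePair encodeBool encodeℕ l)
    w = size (encodeℕ c)
    e = size (encodeEdges es)
    v = size (encodeℕ (literal l))

  module AddLiterals = Fold addLiteralᴾ width width≤size (con 0) (con 2 ⊕ grow literalᴾ ⊕ X)
    (λ l st → ≤-refl) (λ l (c , es) → addLiteral-grows l c es)

  addClauseᴾ : PolyTime
      (encodePair (encodeList (encodePair encodeBool encodeℕ)) encodePartial) encodePartial addClause
  addClauseᴾ = pair (sucᴾ ⊚ first) second ⊚ AddLiterals.foldᴾ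

  addLiterals-proj₁ : ∀ ls c es → proj₁ (AddLiterals.fold ls (c , es)) ≡ c
  addLiterals-proj₁ []       c es = refl
  addLiterals-proj₁ (l ∷ ls) c es = addLiterals-proj₁ ls c ((literal l , c) ∷ es)

  -- A clause advances the counter by one, which adds 2 to its unary size; the edge list grows by
  -- the total increment of the inner fold over literals.
  module AddClauses = Fold addClauseᴾ width width≤size (con 2) (con 2 ⊕ AddLiterals.increment)
    (λ ls (c , es) → ≤-reflexive (cong (λ k → 2 + size (encodeℕ k)) (addLiterals-proj₁ ls c es)))
    (λ ls st → +-monoʳ-≤ 2 (AddLiterals.fold-grows ls st))

  reductionᴾ : PolyTime encodeRawCNF encodePartial reduction
  reductionᴾ = AddClauses.foldᴾ ⊚
    pair second (addGadgetsᴾ ⊚ pair (halfᴾ ⊚ first) (pair (constant 0 refl) (constant [] refl)))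

  -- With `k` the MMVC value, `n` the number of vertices and `g` the number of gadgets, the
  -- threshold `n ≤ k + g * 3` holds iff `n ∸ k ∸ g * 3` vanishes. Subtraction of unary numbers is
  -- repeated `pred`.
  test : ℕ × (ℕ × ℕ) → Bool
  test (k , (n , g)) = isZero (iterate (pred ∘ pred ∘ pred) (iterate pred n k) g)

  opaque
    testᴾ : PolyTime (encodePair encodeℕ (encodePair encodeℕ encodeℕ)) encodeBool test
    testᴾ = isZeroᴾ ⊚ J.iterateᴾ ⊚
      pair (second ⊚ second) (I.iterateᴾ ⊚ pair first (first ⊚ second))
      where
      module I = Iterate predᴾ (const 0) (λ _ → z≤n) 0 (con 0) (λ _ → z≤n) (grows predᴾ)
      module J = Iterate (predᴾ ⊚ predᴾ ⊚ predᴾ) (const 0) (λ _ → z≤n) 0 (con 0) (λ _ → z≤n)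
        (grows (predᴾ ⊚ predᴾ ⊚ predᴾ))

-- Correctness of the reduction: the gadget, the graph and the equivalence.

module GraphOfFormula where

  open PolynomialTime
  open import Data.Bool.Base using (Bool; true; false; not; _∧_; _∨_; _xor_; T)
      renaming (if_then_else_ to ifᵇ_then_else_)
  open import Data.Bool.ListAction using (any; all)
  import Data.Bool.Properties as Bool
  open import Data.Bool.Properties using (T?)
  open import Data.Empty using (⊥)
  open import Data.Fin.Base using (Fin; zero; suc; toℕ; fromℕ<)
  import Data.Fin.Properties as Fin
  open import Data.Fin.Properties using (toℕ-fromℕ<; toℕ<n; toℕ-injective)
  open import Data.Fin.Subset using (Subset; ∣_∣; _∈_; _∉_; _⊂_)
  open import Data.Fin.Subset.Properties using (anySubset?)
  open import Data.List.Base as List using (List; []; _∷_; _++_; map; foldl; length)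
  open import Data.List.Membership.Propositional.Properties using (∈-lookup; ∈-upTo⁺)
  open import Data.List.Relation.Unary.All as All using (All; []; _∷_)
  import Data.List.Relation.Unary.All.Properties as All
  open import Data.List.Relation.Unary.Any as Any using (Any)
  import Data.List.Relation.Unary.Any.Properties as Any
  open import Data.Nat.Base
  open import Data.Nat.DivMod
  open import Data.Nat.Divisibility using (n∣m*n)
  open import Data.Nat.GeneralisedArithmetic using (iterate; fold; iterate-is-fold)
  open import Data.Nat.Properties
  open import Data.Product.Base using (_×_; _,_; proj₁; proj₂)
  open import Data.Sum.Base using (_⊎_; inj₁; inj₂)
  open import Data.Vec.Base using (Vec; []; _∷_; tabulate; lookup; _[_]≔_)
  open import Data.Vec.Properties using ([]=⇒lookup; lookup⇒[]=; lookup∘tabulate)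
  open import Function.Base using (_∘_; flip)
  open import Function.Bundles using (Equivalence)
  open import Relation.Binary.PropositionalEquality
  open import Relation.Nullary
  open import Relation.Nullary.Decidable using (True; toWitness)

  -- Characteristic functions on all of `ℕ`, false out of range, permit block arithmetic on vertices
  -- without bounds in their types.
  at : ∀ {n} → Vec Bool n → ℕ → Bool
  at []       k       = false
  at (b ∷ bs) zero    = b
  at (b ∷ bs) (suc k) = at bs k

  weight : Bool → ℕ
  weight false = 0
  weight true  = 1

  count : (ℕ → Bool) → ℕ → ℕ
  count f zero    = 0
  count f (suc n) = weight (f n) + count f n

  touches : (ℕ → Bool) → ℕ → Edge → Bool
  touches h j (p , q) = (p ≡ᵇ j) ∧ h q ∨ (q ≡ᵇ j) ∧ h p

  dominated : (ℕ → Bool) → ℕ → Bool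
  dominated h j = any (touches h j) gadget

  independent : (ℕ → Bool) → Bool
  independent h = all (λ (p , q) → not (h p ∧ h q)) gadget

  -- The slots are a parameter because a literal may also be dominated by a clause vertex; at first,
  -- maximality inside the gadget is known only at `checks`.
  maximalAt : List ℕ → (ℕ → Bool) → Bool
  maximalAt js h = all (λ j → h j ∨ dominated h j) js

  literals checks : List ℕ
  literals = 0 ∷ 1 ∷ 6 ∷ 7 ∷ []
  checks   = 2 ∷ 3 ∷ 4 ∷ 5 ∷ 8 ∷ 9 ∷ 10 ∷ 11 ∷ []

  solution : Bool → Bool → Vec Bool 12
  solution a b = a ∷ not a ∷ false ∷ false ∷ (not a ∧ not b) ∷ (not a ∧ b) ∷
                 b ∷ not b ∷ false ∷ false ∷ (a ∧ not b) ∷ (a ∧ b) ∷ []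

  -- The implicit argument is solved by evaluating a search for a counterexample among all subsets,
  -- 4096 of them for a gadget.
  bruteForce : ∀ {n} (P : Subset n → Bool) →
               {_ : False (anySubset? (λ h → T? (not (P h))))} → ∀ h → P h ≡ true
  bruteForce P {none} h with P h in eq
  ... | true  = refl
  ... | false = contradiction (h , subst (T ∘ not) (sym eq) _) (toWitnessFalse none)

  implies : Bool → Bool → Bool
  implies a b = not a ∨ b

  three≤ : (h : Subset 12) → implies (maximalAt checks (at h)) (3 ≤ᵇ count (at h) 12) ≡ true
  three≤ = bruteForce _

  -- The case excluded by `maximalAt literals` is that of three selected literals; every other
  -- violation has more than 3 elements.
  assigns : (h : Subset 12) →
    implies (independent (at h) ∧ maximalAt literals (at h) ∧ maximalAt checks (at h) ∧
        (count (at h) 12 ≤ᵇ 3))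
            ((at h 0 xor at h 1) ∧ (at h 6 xor at h 7)) ≡ true
  assigns = bruteForce _

  any≡false⇒All : ∀ {A : Set} (f : A → Bool) xs → any f xs ≡ false → All (λ x → f x ≡ false) xs
  any≡false⇒All f []       eq = []
  any≡false⇒All f (x ∷ xs) eq with f x in fx
  ... | false = fx ∷ any≡false⇒All f xs eq

  All⇒any≡false : ∀ {A : Set} (f : A → Bool) {xs} → All (λ x → f x ≡ false) xs → any f xs ≡ false
  All⇒any≡false f []         = refl
  All⇒any≡false f (eq ∷ eqs) rewrite eq = All⇒any≡false f eqs

  all≡true⇒All : ∀ {A : Set} (f : A → Bool) xs → all f xs ≡ true → All (λ x → f x ≡ true) xs
  all≡true⇒All f []       eq = []
  all≡true⇒All f (x ∷ xs) eq with f x in fx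
  ... | true = fx ∷ all≡true⇒All f xs eq

  All⇒all≡true : ∀ {A : Set} (f : A → Bool) {xs} → All (λ x → f x ≡ true) xs → all f xs ≡ true
  All⇒all≡true f []         = refl
  All⇒all≡true f (eq ∷ eqs) rewrite eq = All⇒all≡true f eqs

  count-cong : ∀ {f g : ℕ → Bool} n → (∀ v → v < n → f v ≡ g v) → count f n ≡ count g n
  count-cong zero    f≗g = refl
  count-cong (suc n) f≗g =
      cong₂ _+_ (cong weight (f≗g n ≤-refl)) (count-cong n λ v v<n → f≗g v (m≤n⇒m≤1+n v<n))

  count-+ : ∀ f m n → count f (m + n) ≡ count (λ v → f (v + n)) m + count f n
  count-+ f zero    n = refl
  count-+ f (suc m) n =
      trans (cong (weight (f (m + n)) +_) (count-+ f m n)) (sym (+-assoc (weight (f (m + n))) _ _))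

  count-not : ∀ f n → count f n + count (not ∘ f) n ≡ n
  count-not f zero    = refl
  count-not f (suc n) with f n
  ... | true  = cong suc (count-not f n)
  ... | false = trans (+-suc _ _) (cong suc (count-not f n))

  -- `count` recurses from the largest index, whereas a vector is peeled from its smallest.
  count-suc : ∀ f n → count f (suc n) ≡ weight (f 0) + count (f ∘ suc) n
  count-suc f zero    = refl
  count-suc f (suc n) = begin
    weight (f (suc n)) + count f (suc n)
        ≡⟨ cong (weight (f (suc n)) +_) (count-suc f n) ⟩
    weight (f (suc n)) + (weight (f 0) + count (f ∘ suc) n) ≡⟨ +-assoc (weight (f (suc n))) _ _ ⟨
    weight (f (suc n)) + weight (f 0) + count (f ∘ suc) n
        ≡⟨ cong (_+ count (f ∘ suc) n) (+-comm (weight (f (suc n))) _) ⟩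
    weight (f 0) + weight (f (suc n)) + count (f ∘ suc) n   ≡⟨ +-assoc (weight (f 0)) _ _ ⟩
    weight (f 0) + (weight (f (suc n)) + count (f ∘ suc) n) ∎
    where open ≡-Reasoning

  count≡0 : ∀ f n → count f n ≤ 0 → ∀ {v} → v < n → f v ≡ false
  count≡0 f (suc n) ≤0 {v} v<1+n with f n in fn
  count≡0 f (suc n) () {v} v<1+n | true
  ... | false with m≤n⇒m<n∨m≡n (s≤s⁻¹ v<1+n)
  ...   | inj₁ v<n  = count≡0 f n ≤0 v<n
  ...   | inj₂ refl = fn

  count-none : ∀ f n → (∀ v → v < n → f v ≡ false) → count f n ≡ 0
  count-none f zero    none = refl
  count-none f (suc n) none rewrite none n ≤-refl = count-none f n λ v v<n → none v (m≤n⇒m≤1+n v<n)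

  module _ (f : ℕ → Bool) where

    private
      block : ℕ → ℕ
      block g = count (λ j → f (j + g * 12)) 12

    count-blocks : ∀ k n → (∀ g → g < n → block g ≡ k) → count f (n * 12) ≡ n * k
    count-blocks k zero    eq = refl
    count-blocks k (suc n) eq = trans (count-+ f 12 (n * 12))
      (cong₂ _+_ (eq n ≤-refl) (count-blocks k n λ g g<n → eq g (m≤n⇒m≤1+n g<n)))

    count-blocks-≥ : ∀ k n → (∀ g → g < n → k ≤ block g) → n * k ≤ count f (n * 12)
    count-blocks-≥ k zero    k≤ = z≤n
    count-blocks-≥ k (suc n) k≤ = ≤-trans
      (+-mono-≤ (k≤ n ≤-refl) (count-blocks-≥ k n λ g g<n → k≤ g (m≤n⇒m≤1+n g<n)))
      (≤-reflexive (sym (count-+ f 12 (n * 12))))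

    -- Each block costs at least k, so none can exceed its share of the total.
    count-blocks-tight : ∀ k n → (∀ g → g < n → k ≤ block g) → count f (n * 12) ≤ n * k →
                         ∀ {g} → g < n → block g ≤ k
    count-blocks-tight k (suc n) k≤ total {g} g<1+n = go (m≤n⇒m<n∨m≡n (s≤s⁻¹ g<1+n))
      where
      k≤′ : ∀ g → g < n → k ≤ block g
      k≤′ g g<n = k≤ g (m≤n⇒m≤1+n g<n)
      total′ : block n + count f (n * 12) ≤ k + n * k
      total′ = ≤-trans (≤-reflexive (sym (count-+ f 12 (n * 12)))) total
      go : g < n ⊎ g ≡ n → block g ≤ k
      go (inj₁ g<n)  = count-blocks-tight k n k≤′
        (+-cancelˡ-≤ k _ _ (≤-trans (+-monoˡ-≤ _ (k≤ n ≤-refl)) total′)) g<n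
      go (inj₂ refl) = +-cancelʳ-≤ (n * k) _ _
          (≤-trans (+-monoʳ-≤ (block n) (count-blocks-≥ k n k≤′)) total′)

  ∣∣≡count : ∀ {n} (S : Subset n) → ∣ S ∣ ≡ count (at S) n
  ∣∣≡count []          = refl
  ∣∣≡count {suc n} (true  ∷ S) = trans (cong suc (∣∣≡count S)) (sym (count-suc (at (true ∷ S)) n))
  ∣∣≡count {suc n} (false ∷ S) = trans (∣∣≡count S) (sym (count-suc (at (false ∷ S)) n))

  lookup≡at : ∀ {n} (S : Vec Bool n) i → lookup S i ≡ at S (toℕ i)
  lookup≡at (b ∷ S) zero    = refl
  lookup≡at (b ∷ S) (suc i) = lookup≡at S i

  ∈⇒at : ∀ {n} {S : Subset n} {i} → i ∈ S → at S (toℕ i) ≡ true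
  ∈⇒at {S = S} {i} i∈S = trans (sym (lookup≡at S i)) ([]=⇒lookup i∈S)

  at⇒∈ : ∀ {n} {S : Subset n} {i} → at S (toℕ i) ≡ true → i ∈ S
  at⇒∈ {S = S} {i} eq = lookup⇒[]= i S (trans (lookup≡at S i) eq)

  subset : (ℕ → Bool) → ∀ n → Subset n
  subset f n = tabulate (f ∘ toℕ)

  at-subset : ∀ f n {v} → v < n → at (subset f n) v ≡ f v
  at-subset f (suc n) {zero}  v<n       = refl
  at-subset f (suc n) {suc v} (s≤s v<n) = at-subset (f ∘ suc) n v<n

  ∣subset∣ : ∀ f n → ∣ subset f n ∣ ≡ count f n
  ∣subset∣ f n = trans (∣∣≡count (subset f n)) (count-cong n λ v v<n → at-subset f n v<n)

  block-% : ∀ {j} g → j < 12 → (j + g * 12) % 12 ≡ j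
  block-% {j} g j<12 = trans ([m+kn]%n≡m%n j g 12) (m<n⇒m%n≡m j<12)

  block-/ : ∀ j g → (j + g * 12) / 12 ≡ j / 12 + g
  block-/ j g = trans (+-distrib-/-∣ʳ j (n∣m*n g)) (cong (j / 12 +_) (m*n/n≡m g 12))

  block-unique : ∀ {i j g h} → i < 12 → j < 12 → i + g * 12 ≡ j + h * 12 → i ≡ j × g ≡ h
  block-unique {i} {j} {g} {h} i<12 j<12 eq =
    i≡j , *-cancelʳ-≡ g h 12 (+-cancelˡ-≡ i _ _ (trans eq (cong (_+ h * 12) (sym i≡j))))
    where
    i≡j : i ≡ j
    i≡j = trans (sym (block-% g i<12)) (trans (cong (_% 12) eq) (block-% h j<12))

  block-< : ∀ {j g n} → j < 12 → g < n → j + g * 12 < n * 12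
  block-< {j} {g} {n} j<12 g<n = ≤-trans (+-monoˡ-≤ (g * 12) j<12) (*-monoˡ-≤ 12 g<n)

  -- A function given blockwise below G * 12 and false elsewhere.
  blockwise : ℕ → (ℕ → ℕ → Bool) → ℕ → Bool
  blockwise G β v = ifᵇ v / 12 <ᵇ G then β (v / 12) (v % 12) else false

  blockwise-below : ∀ {G} β {g j} → g < G → j < 12 → blockwise G β (j + g * 12) ≡ β g j
  blockwise-below {G} β {g} {j} g<G j<12
    rewrite block-% g j<12 | block-/ j g | m<n⇒m/n≡0 j<12 | Equivalence.to Bool.T-≡ (<⇒<ᵇ g<G) = refl

  blockwise-above : ∀ G β j → blockwise G β (j + G * 12) ≡ false
  blockwise-above G β j rewrite block-/ j G with j / 12 + G <ᵇ G in eq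
  ... | false = refl
  ... | true  = contradiction (<ᵇ⇒< (j / 12 + G) G (subst T (sym eq) _)) (≤⇒≯ (m≤n+m G (j / 12)))

  -- The edge list produced by the reduction.

  Clause : Set
  Clause = List (Bool × ℕ)

  gadgets : ℕ → List Edge
  gadgets zero    = []
  gadgets (suc g) = map (shift (g * 12)) gadget ++ gadgets g

  addGadgets : ∀ g → iterate addGadget (0 , []) g ≡ (g * 12 , gadgets g)
  -- `iterate` accumulates in its argument; `fold` keeps the last gadget outermost, which is where
  -- `gadgets` recurses.
  addGadgets g = trans (sym (iterate-is-fold (0 , []) addGadget g)) (go g)
    where
    go : ∀ g → fold (0 , []) addGadget g ≡ (g * 12 , gadgets g)
    go zero    = refl
    go (suc g) = cong addGadget (go g)

  module _ {P : Edge → Set} where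

    gadgets⁺ : ∀ n → (∀ g → g < n → All (P ∘ shift (g * 12)) gadget) → All P (gadgets n)
    gadgets⁺ zero    p = []
    gadgets⁺ (suc n) p = All.++⁺ (All.map⁺ (p n ≤-refl)) (gadgets⁺ n λ g g<n → p g (m≤n⇒m≤1+n g<n))

    gadgets⁻ : ∀ n → All P (gadgets n) → ∀ {g} → g < n → All (P ∘ shift (g * 12)) gadget
    gadgets⁻ (suc n) p {g} g<1+n with m≤n⇒m<n∨m≡n (s≤s⁻¹ g<1+n)
    ... | inj₁ g<n  = gadgets⁻ n (All.++⁻ʳ (map (shift (n * 12)) gadget) p) g<n
    ... | inj₂ refl = All.map⁻ (All.++⁻ˡ (map (shift (n * 12)) gadget) p)

    addLiterals⁺ : ∀ ls {c es} → All P es → All (λ l → P (literal l , c)) ls →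
                   All P (proj₂ (foldl (λ s l → addLiteral (l , s)) (c , es) ls))
    addLiterals⁺ []       p q        = p
    addLiterals⁺ (l ∷ ls) p (ql ∷ q) = addLiterals⁺ ls (ql ∷ p) q

    addLiterals⁻ : ∀ ls {c es} → All P (proj₂ (foldl (λ s l → addLiteral (l , s)) (c , es) ls)) →
                   All P es × All (λ l → P (literal l , c)) ls
    addLiterals⁻ []       p = p , []
    addLiterals⁻ (l ∷ ls) p with addLiterals⁻ ls p
    ... | pl ∷ p , q = p , pl ∷ q

  addClauses : ℕ × List Edge → List Clause → ℕ × List Edge
  addClauses = foldl (λ s c → addClause (c , s))

  module _ {P : Edge → Set} where

    AllClauses : ℕ → List Clause → Set
    AllClauses c cs = ∀ k → All (λ l → P (literal l , toℕ k + c)) (List.lookup cs k)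

    addClauses⁺ : ∀ cs {c es} → All P es → AllClauses c cs → All P (proj₂ (addClauses (c , es) cs))
    addClauses⁺ []       p q = p
    addClauses⁺ (ls ∷ cs) {c} {es} p q = subst (λ d →
        All P (proj₂ (addClauses (suc d , proj₂ (foldl (λ s l → addLiteral (l , s)) (c , es) ls)) cs)))
      (sym (addLiterals-proj₁ ls c es))
      (addClauses⁺ cs (addLiterals⁺ ls p (q zero))
        λ k → subst (λ d → All (λ l → P (literal l , d)) (List.lookup cs k)) (sym (+-suc (toℕ k) c))
            (q (suc k)))

    addClauses⁻ : ∀ cs {c es} → All P (proj₂ (addClauses (c , es) cs)) → All P es × AllClauses c cs
    addClauses⁻ []       p = p , λ ()
    addClauses⁻ (ls ∷ cs) {c} {es} p
      with addClauses⁻ cs (subst (λ d → All P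
          (proj₂ (addClauses (suc d , proj₂ (foldl (λ s l → addLiteral (l , s)) (c , es) ls)) cs)))
             (addLiterals-proj₁ ls c es) p)
    ... | p , q with addLiterals⁻ ls p
    ...   | p , q₀ = p , λ where
      zero    → q₀
      (suc k) → subst (λ d → All (λ l → P (literal l , d)) (List.lookup cs k)) (+-suc (toℕ k) c) (q k)

  addClauses-proj₁ : ∀ cs {c es} → proj₁ (addClauses (c , es) cs) ≡ length cs + c
  addClauses-proj₁ []        = refl
  addClauses-proj₁ (ls ∷ cs) {c} {es} = begin
    proj₁ (addClauses (addClause (ls , (c , es))) cs) ≡⟨ addClauses-proj₁ cs ⟩
    length cs + suc (proj₁ (AddLiterals.fold ls (c , es)))
        ≡⟨ cong (λ d → length cs + suc d) (addLiterals-proj₁ ls c es) ⟩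
    length cs + suc c ≡⟨ +-suc (length cs) c ⟩
    suc (length cs + c) ∎
    where open ≡-Reasoning

  Within : ℕ → Edge → Set
  Within n (u , w) = u < n × w < n

  toFins : ∀ {n} es → All (Within n) es → List (Fin n × Fin n)
  toFins []       []             = []
  toFins (e ∷ es) ((u , w) ∷ bs) = (fromℕ< u , fromℕ< w) ∷ toFins es bs

  encode-toFins : ∀ {n} es (bs : All (Within n) es) →
                  encodeList (encodePair encodeFin encodeFin) (toFins es bs) ≡ encodeEdges es
  encode-toFins []       []             = refl
  encode-toFins (e ∷ es) ((u , w) ∷ bs) =
    cong₂ _∙_ (cong₂ (λ x y → encodeℕ x ∙ encodeℕ y) (toℕ-fromℕ< u) (toℕ-fromℕ< w))
        (encode-toFins es bs)

  module _ {n} {P : Edge → Set} {Q : Fin n × Fin n → Set} where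

    toFins⁺ : (∀ {u w} → P (toℕ u , toℕ w) → Q (u , w)) → ∀ {es} (bs : All (Within n) es) →
              All P es → All Q (toFins es bs)
    toFins⁺ f []             []       = []
    toFins⁺ f ((u , w) ∷ bs) (p ∷ ps) =
      f (subst₂ (λ x y → P (x , y)) (sym (toℕ-fromℕ< u)) (sym (toℕ-fromℕ< w)) p) ∷ toFins⁺ f bs ps

    toFins⁻ : (∀ {u w} → Q (u , w) → P (toℕ u , toℕ w)) → ∀ {es} (bs : All (Within n) es) →
              All Q (toFins es bs) → All P es
    toFins⁻ f []             []       = []
    toFins⁻ f ((u , w) ∷ bs) (q ∷ qs) =
      subst₂ (λ x y → P (x , y)) (toℕ-fromℕ< u) (toℕ-fromℕ< w) (f q) ∷ toFins⁻ f bs qs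

  leftSlots : Vec Bool 12
  leftSlots = true ∷ true ∷ false ∷ false ∷ false ∷ false ∷
              true ∷ true ∷ false ∷ false ∷ false ∷ false ∷ []

  -- Variables `2h` and `2h + 1` share gadget `h`; the constructor tells which half of it holds
  -- variable `i`.
  data Slot (n i : ℕ) : Set where
    even : ∀ {h} → h < ⌈ n /2⌉ → i ≡ h * 2 → Slot n i
    odd  : ∀ {h} → h < ⌈ n /2⌉ → i ≡ suc (h * 2) → Slot n i

  slot : ∀ {n i} → i < n → Slot n i
  slot {suc n}       {zero}        _         = even z<s refl
  slot {suc (suc n)} {suc zero}    _         = odd z<s refl
  slot {suc zero}    {suc _}       (s≤s ())
  slot {suc (suc n)} {suc (suc i)} (s≤s (s≤s i<n)) with slot i<n
  ... | even h< eq = even (s≤s h<) (cong (2 +_) eq)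
  ... | odd  h< eq = odd (s≤s h<) (cong (2 +_) eq)

  gadget<12 : All (λ (p , q) → p < 12 × q < 12) gadget
  gadget<12 = from-yes (All.all? (λ (p , q) → (p <? 12) ×-dec (q <? 12)) gadget)

  touches≡false⁺ : ∀ {h j p q} → (p ≡ j → h q ≡ false) → (q ≡ j → h p ≡ false) →
                   touches h j (p , q) ≡ false
  touches≡false⁺ {h} {j} {p} {q} f g = cong₂ _∨_ (half f) (half g)
    where
    half : ∀ {r b} → (r ≡ j → b ≡ false) → (r ≡ᵇ j) ∧ b ≡ false
    half {r} f with r ≡ᵇ j in eq
    ... | true  = f (≡ᵇ⇒≡ r j (subst T (sym eq) _))
    ... | false = refl

  touches≡false⁻ : ∀ {h j p q} → touches h j (p , q) ≡ false →
                   (p ≡ j → h q ≡ false) × (q ≡ j → h p ≡ false)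
  touches≡false⁻ {h} {j} {p} {q} eq =
      (λ { refl → subst (λ b → b ∧ h q ≡ false) (≡ᵇ-refl p) (Bool.∨-conicalˡ ((p ≡ᵇ p) ∧ h q) _ eq) })
    , (λ { refl → subst (λ b → b ∧ h p ≡ false) (≡ᵇ-refl q) (Bool.∨-conicalʳ ((p ≡ᵇ q) ∧ h q) _ eq) })
    where
    ≡ᵇ-refl : ∀ n → (n ≡ᵇ n) ≡ true
    ≡ᵇ-refl zero    = refl
    ≡ᵇ-refl (suc n) = ≡ᵇ-refl n

  at-[]≔ : ∀ {n} (S : Vec Bool n) i b → at (S [ i ]≔ b) (toℕ i) ≡ b
  at-[]≔ (_ ∷ S) zero    b = refl
  at-[]≔ (_ ∷ S) (suc i) b = at-[]≔ S i b

  at-[]≔-other : ∀ {n} (S : Vec Bool n) i b {v} → v ≢ toℕ i → at (S [ i ]≔ b) v ≡ at S v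
  at-[]≔-other (_ ∷ S) zero    b {zero}  v≢i = contradiction refl v≢i
  at-[]≔-other (_ ∷ S) zero    b {suc v} v≢i = refl
  at-[]≔-other (_ ∷ S) (suc i) b {zero}  v≢i = refl
  at-[]≔-other (_ ∷ S) (suc i) b {suc v} v≢i = at-[]≔-other S i b (v≢i ∘ cong suc)

  implies-elim : ∀ {a b} → implies a b ≡ true → a ≡ true → b ≡ true
  implies-elim eq refl = eq

  xor-not : ∀ a b → a xor b ≡ true → b ≡ true → a ≡ false
  xor-not true  true  () _
  xor-not false true  _  _ = refl

  -- The bipartite graph of a formula.

  module Construction (φ : CNF) where

    open CNF φ

    rawClauses : List Clause
    rawClauses = map (map (λ (s , i) → s , toℕ i)) clauses

    raw : RawCNF
    raw = vars , rawClauses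

    encode-raw : encodeCNF ≡ encodeRawCNF raw
    encode-raw = cong (encodeℕ vars ∙_) (go clauses)
      where
      go₁ : (ls : List (Literal vars)) → encodeList (encodePair encodeBool encodeFin) ls ≡
            encodeList (encodePair encodeBool encodeℕ) (map (λ (s , i) → s , toℕ i) ls)
      go₁ []       = refl
      go₁ (l ∷ ls) = cong (_ ∙_) (go₁ ls)
      go : (cs : List (List (Literal vars))) →
          encodeList (encodeList (encodePair encodeBool encodeFin)) cs ≡
           encodeList (encodeList (encodePair encodeBool encodeℕ))
               (map (map (λ (s , i) → s , toℕ i)) cs)
      go []       = refl
      go (c ∷ cs) = cong₂ _∙_ (go₁ c) (go cs)

    G m N : ℕ
    G = ⌈ vars /2⌉
    m = length rawClauses
    N = m + G * 12

    edges : List Edge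
    edges = proj₂ (addClauses (G * 12 , gadgets G) rawClauses)

    reduction-raw : reduction raw ≡ (N , edges)
    reduction-raw = trans (cong (λ st → addClauses st rawClauses) (addGadgets G))
                          (cong (_, edges) (addClauses-proj₁ rawClauses))

    clause : Fin m → Clause
    clause = List.lookup rawClauses

    variables< : ∀ k → All (λ (s , i) → i < vars) (clause k)
    variables< k = All.lookup {P = All (λ (s , i) → i < vars)}
      (All.map⁺ (All.universal (λ c → All.map⁺ (All.universal (λ (s , i) → toℕ<n i) c)) clauses))
          (∈-lookup k)

    -- Together with `edges⁻` this is the interface to the edge list: gadgets shifted to their
    -- blocks, and clause `k` at vertex `k + G * 12`. Later facts about edges come from a choice of
    -- `P`.
    edges⁺ : ∀ {P : Edge → Set} → (∀ g → g < G → All (P ∘ shift (g * 12)) gadget) →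
             (∀ k → All (λ l → P (literal l , toℕ k + G * 12)) (clause k)) → All P edges
    edges⁺ p q = addClauses⁺ rawClauses (gadgets⁺ G p) q

    edges⁻ : ∀ {P : Edge → Set} → All P edges → (∀ {g} → g < G → All (P ∘ shift (g * 12)) gadget) ×
             (∀ k → All (λ l → P (literal l , toℕ k + G * 12)) (clause k))
    edges⁻ p = let p , q = addClauses⁻ rawClauses p in gadgets⁻ G p , q

    isLeft : ℕ → Bool
    isLeft = blockwise G (λ _ → at leftSlots)

    literal-left : ∀ s {i} → i < vars → isLeft (literal (s , i)) ≡ true
    literal-left s     i<n with slot i<n
    literal-left true  i<n | even {h} h< refl rewrite *-assoc h 2 6 =
        blockwise-below (λ _ → at leftSlots) {j = 0} h< (m≤m+n _ _)
    literal-left false i<n | even {h} h< refl rewrite *-assoc h 2 6 =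
        blockwise-below (λ _ → at leftSlots) {j = 1} h< (m≤m+n _ _)
    literal-left true  i<n | odd {h} h< refl rewrite *-assoc h 2 6 =
        blockwise-below (λ _ → at leftSlots) {j = 6} h< (m≤m+n _ _)
    literal-left false i<n | odd {h} h< refl rewrite *-assoc h 2 6 =
        blockwise-below (λ _ → at leftSlots) {j = 7} h< (m≤m+n _ _)

    left<N : ∀ {v} → isLeft v ≡ true → v < G * 12
    left<N {v} eq with v / 12 <ᵇ G in q
    ... | true = begin-strict
      v                       ≡⟨ m≡m%n+[m/n]*n v 12 ⟩
      v % 12 + v / 12 * 12    <⟨ block-< (m%n<n v 12) (<ᵇ⇒< (v / 12) G (subst T (sym q) _)) ⟩
      G * 12                  ∎
      where open ≤-Reasoning

    clauseVertex<N : ∀ (k : Fin m) → toℕ k + G * 12 < N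
    clauseVertex<N k = +-monoˡ-< (G * 12) (toℕ<n k)

    -- Each edge is listed with its literal endpoint first. This one invariant yields the vertex
    -- bounds, looplessness, the bipartition and the cover `A`.
    Oriented : Edge → Set
    Oriented (u , w) = isLeft u ≡ true × isLeft w ≡ false × w < N

    oriented : All Oriented edges
    oriented = edges⁺
      (λ g g<G → All.map (λ {(p , q)} (lp , lq , p< , q<) →
          trans (blockwise-below (λ _ → at leftSlots) g<G p<) lp
        , trans (blockwise-below (λ _ → at leftSlots) g<G q<) lq
        , ≤-trans (block-< q< g<G) (m≤n+m (G * 12) m)) slots)
      (λ k → All.map (λ {(s , i)} i< →
          literal-left s i< , blockwise-above G (λ _ → at leftSlots) (toℕ k) , clauseVertex<N k)
        (variables< k))
      where
      slots : All (λ (p , q) → at leftSlots p ≡ true × at leftSlots q ≡ false × p < 12 × q < 12) gadget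
      slots = from-yes (All.all?
          (λ (p , q) → (at leftSlots p Bool.≟ true) ×-dec (at leftSlots q Bool.≟ false)
                                                ×-dec (p <? 12) ×-dec (q <? 12)) gadget)

    within : All (Within N) edges
    within = All.map (λ (lu , _ , w<) → ≤-trans (left<N lu) (m≤n+m (G * 12) m) , w<) oriented

    graph : Graph
    graph = record
      { order    = N
      ; edges    = toFins edges within
      ; loopless = toFins⁺ {P = Oriented}
          (λ { (lu , lw , _) refl → contradiction (trans (sym lu) lw) (λ ()) }) within oriented
      }

    encode-graph : Graph.encodeGraph graph ≡ encodePartial (reduction raw)
    encode-graph = trans (cong (encodeℕ N ∙_) (encode-toFins edges within))
        (cong encodePartial (sym reduction-raw))

    A : Subset N
    A = subset isLeft N

    at-A : ∀ i → at A (toℕ i) ≡ isLeft (toℕ i)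
    at-A i = at-subset isLeft N (toℕ<n i)

    bipartite : Graph.Bipartite graph
    bipartite = A , toFins⁺ {P = Oriented} (λ {u} {w} (lu , lw , _) →
        inj₁ (at⇒∈ (trans (at-A u) lu) , λ w∈A →
            contradiction (trans (sym (trans (sym (at-A w)) (∈⇒at w∈A))) lw) λ ()))
      within oriented

    A-cover : Graph.VertexCover graph A
    A-cover = toFins⁺ {P = Oriented} (λ {u} (lu , _) → inj₁ (at⇒∈ (trans (at-A u) lu))) within oriented

    ∣A∣ : ∣ A ∣ ≡ G * 4
    ∣A∣ = begin
      ∣ A ∣                                                   ≡⟨ ∣subset∣ isLeft N ⟩
      count isLeft (m + G * 12)                               ≡⟨ count-+ isLeft m (G * 12) ⟩
      count (λ k → isLeft (k + G * 12)) m + count isLeft (G * 12) ≡⟨ cong₂ _+_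
        (count-none _ m λ k _ → blockwise-above G (λ _ → at leftSlots) k)
        (count-blocks isLeft 4 G λ g g<G → count-cong {g = at leftSlots} 12 λ j j<12 →
            blockwise-below (λ _ → at leftSlots) g<G j<12) ⟩
      G * 4                                                   ∎
      where open ≡-Reasoning

    vc≤ : ∀ k → Graph.IsVc graph k → k ≤ G * 4
    vc≤ k (_ , least) = ≤-trans (least A A-cover) (≤-reflexive ∣A∣)

    Covers : (ℕ → Bool) → Edge → Set
    Covers s (u , w) = s u ≡ true ⊎ s w ≡ true

    toCover : ∀ S → All (Covers (at S)) edges → Graph.VertexCover graph S
    toCover S = toFins⁺ (λ { (inj₁ u) → inj₁ (at⇒∈ u) ; (inj₂ w) → inj₂ (at⇒∈ w) }) within

    fromCover : ∀ S → Graph.VertexCover graph S → All (Covers (at S)) edges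
    fromCover S = toFins⁻ (λ { (inj₁ u) → inj₁ (∈⇒at u) ; (inj₂ w) → inj₂ (∈⇒at w) }) within

    at-S : ∀ f {v} → v < N → at (subset f N) v ≡ f v
    at-S f = at-subset f N

    -- From a satisfying assignment to a large minimal vertex cover.

    module Completeness (α : Fin vars → Bool) (sat : All (Any (λ (s , i) → α i ≡ s)) clauses) where

      α′ : ℕ → Bool
      -- For odd `vars` the last gadget asks for a variable out of range; `at` then answers false.
      α′ = at (tabulate α)

      α′≡α : ∀ i → α′ (toℕ i) ≡ α i
      α′≡α i = trans (sym (lookup≡at (tabulate α) i)) (lookup∘tabulate α i)

      β : ℕ → ℕ → Bool
      β g = at (solution (α′ (g * 2)) (α′ (suc (g * 2))))

      I : ℕ → Bool
      I = blockwise G β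

      S : Subset N
      S = subset (not ∘ I) N

      below : ∀ {g j} → g < G → j < 12 → I (j + g * 12) ≡ β g j
      below = blockwise-below β

      true-literal : ∀ s {i} → i < vars → α′ i ≡ s → I (literal (s , i)) ≡ true
      true-literal s     i<n αi with slot i<n
      true-literal true  i<n αi | even {h} h< refl rewrite *-assoc h 2 6 =
          trans (below {j = 0} h< (m≤m+n _ _)) αi
      true-literal false i<n αi | even {h} h< refl rewrite *-assoc h 2 6 =
          trans (below {j = 1} h< (m≤m+n _ _)) (cong not αi)
      true-literal true  i<n αi | odd {h} h< refl rewrite *-assoc h 2 6 =
          trans (below {j = 6} h< (m≤m+n _ _)) αi
      true-literal false i<n αi | odd {h} h< refl rewrite *-assoc h 2 6 =
          trans (below {j = 7} h< (m≤m+n _ _)) (cong not αi)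

      satisfied : ∀ k → Any (λ l → I (literal l) ≡ true) (clause k)
      satisfied k = All.lookup {P = Any (λ l → I (literal l) ≡ true)}
        (All.map⁺ (All.map (λ c →
            Any.map⁺ (Any.map (λ {(s , i)} αi → true-literal s (toℕ<n i) (trans (α′≡α i) αi)) c)) sat))
        (∈-lookup k)

      solution-independent : ∀ a b → independent (at (solution a b)) ≡ true
      solution-independent true  true  = refl
      solution-independent true  false = refl
      solution-independent false true  = refl
      solution-independent false false = refl

      solution-maximal : ∀ a b → maximalAt (List.upTo 12) (at (solution a b)) ≡ true
      solution-maximal true  true  = refl
      solution-maximal true  false = refl
      solution-maximal false true  = refl
      solution-maximal false false = refl

      solution-count : ∀ a b → count (at (solution a b)) 12 ≡ 3
      solution-count true  true  = refl
      solution-count true  false = refl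
      solution-count false true  = refl
      solution-count false false = refl

      I-independent : All (λ (u , w) → I u ∧ I w ≡ false) edges
      I-independent = edges⁺
        (λ g g<G → All.zipWith (λ {(p , q)} ((p< , q<) , eq) →
            trans (cong₂ _∧_ (below g<G p<) (below g<G q<)) (Bool.not-injective eq))
          (gadget<12 , all≡true⇒All (λ (p , q) → not (β g p ∧ β g q)) gadget
              (solution-independent (α′ (g * 2)) (α′ (suc (g * 2))))))
        (λ k → All.universal (λ l →
            trans (cong (I (literal l) ∧_) (blockwise-above G β (toℕ k))) (Bool.∧-zeroʳ _)) (clause k))

      S-cover : Graph.VertexCover graph S
      S-cover = toCover S (All.zipWith (λ {(u , w)} ((u< , w<) , eq) → covers u< w< eq)
          (within , I-independent))
        where
        covers : ∀ {u w} → u < N → w < N → I u ∧ I w ≡ false → Covers (at S) (u , w)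
        covers {u} {w} u< w< eq with I u in eqᵤ
        ... | false = inj₁ (trans (at-S (not ∘ I) u<) (cong not eqᵤ))
        ... | true  = inj₂ (trans (at-S (not ∘ I) w<) (cong not eq))

      -- A vertex of `S` missing from `T` lies outside `I`, hence has a neighbour in `I`: in a
      -- gadget by `solution-maximal`, at a clause by a satisfied literal. Neither endpoint of that
      -- edge is in `T`.
      S-minimal : ∀ T → T ⊂ S → ¬ Graph.VertexCover graph T
      S-minimal T (T⊆S , x , x∈S , x∉T) T-cover = by-position (v <? G * 12)
        where
        v = toℕ x

        T-covers : All (Covers (at T)) edges
        T-covers = fromCover T T-cover

        v∉T : at T v ≡ false
        v∉T = Bool.¬-not (x∉T ∘ at⇒∈)

        v∉I : I v ≡ false
        v∉I = Bool.not-injective (trans (sym (at-S (not ∘ I) (toℕ<n x))) (∈⇒at x∈S))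

        disjoint : ∀ {u} → u < N → I u ≡ true → at T u ≡ false
        disjoint {u} u<N u∈I =
            Bool.¬-not λ u∈T → contradiction (trans (sym (∈S u∈T)) (cong not u∈I)) λ ()
          where
          ∈S : at T u ≡ true → not (I u) ≡ true
          ∈S u∈T = trans (sym (at-S (not ∘ I) u<N))
            (subst (λ z → at S z ≡ true) (toℕ-fromℕ< u<N)
              (∈⇒at (T⊆S (at⇒∈ (subst (λ z → at T z ≡ true) (sym (toℕ-fromℕ< u<N)) u∈T)))))

        uncovered : ∀ {u w} → Covers (at T) (u , w) → at T u ≡ false → at T w ≡ false → ⊥
        uncovered (inj₁ eq) u∉T _ = contradiction (trans (sym eq) u∉T) λ ()
        uncovered (inj₂ eq) _ w∉T = contradiction (trans (sym eq) w∉T) λ ()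

        in-gadget : ∀ {g j} → g < G → j < 12 → v ≡ j + g * 12 → ⊥
        in-gadget {g} {j} g<G j<12 v≡ = contradiction (trans (sym maximal) not-maximal) λ ()
          where
          h = β g
          maximal : h j ∨ dominated h j ≡ true
          maximal = All.lookup (all≡true⇒All (λ j → h j ∨ dominated h j) (List.upTo 12)
              (solution-maximal (α′ (g * 2)) (α′ (suc (g * 2))))) (∈-upTo⁺ j<12)
          gadget<N : ∀ {q} → q < 12 → q + g * 12 < N
          gadget<N q< = ≤-trans (block-< q< g<G) (m≤n+m (G * 12) m)
          untouched : ∀ {e} → (proj₁ e < 12 × proj₂ e < 12) × Covers (at T) (shift (g * 12) e) →
              touches h j e ≡ false
          untouched {p , q} ((p< , q<) , c) = touches≡false⁺ {h} {j} {p} {q}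
            (λ { refl → Bool.¬-not λ hq → uncovered c (trans (cong (at T) (sym v≡)) v∉T)
                                                      (disjoint (gadget<N q<)
                                                          (trans (below g<G q<) hq)) })
            (λ { refl → Bool.¬-not λ hp → uncovered c (disjoint (gadget<N p<) (trans (below g<G p<) hp))
                                                      (trans (cong (at T) (sym v≡)) v∉T) })
          not-maximal : h j ∨ dominated h j ≡ false
          not-maximal = cong₂ _∨_ (trans (sym (below g<G j<12)) (trans (cong I (sym v≡)) v∉I))
            (All⇒any≡false (touches h j)
                (All.zipWith untouched (gadget<12 , proj₁ (edges⁻ T-covers) g<G)))

        in-clause : ∀ k → v ≡ toℕ k + G * 12 → ⊥
        in-clause k v≡ = All.lookupWith (λ {(s , i)} (c , i<) literal∈I →
            uncovered c (disjoint (≤-trans (left<N (literal-left s i<)) (m≤n+m (G * 12) m)) literal∈I)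
                        (trans (cong (at T) (sym v≡)) v∉T))
          (All.zip (proj₂ (edges⁻ T-covers) k , variables< k)) (satisfied k)

        by-position : Dec (v < G * 12) → ⊥
        by-position (yes v<) = in-gadget (m<n*o⇒m/o<n v<) (m%n<n v 12) (m≡m%n+[m/n]*n v 12)
        by-position (no v≮)  = in-clause (fromℕ< k<m)
            (trans (sym (m∸n+n≡m (≮⇒≥ v≮))) (cong (_+ G * 12) (sym (toℕ-fromℕ< k<m))))
          where
          k<m : v ∸ G * 12 < m
          k<m = +-cancelʳ-< (G * 12) _ _ (≤-<-trans (≤-reflexive (m∸n+n≡m (≮⇒≥ v≮))) (toℕ<n x))

      ∣S∣ : ∣ S ∣ + G * 3 ≡ N
      ∣S∣ = begin
        ∣ S ∣ + G * 3                     ≡⟨ cong₂ _+_ (∣subset∣ (not ∘ I) N) (sym count-I) ⟩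
        count (not ∘ I) N + count I N     ≡⟨ +-comm (count (not ∘ I) N) (count I N) ⟩
        count I N + count (not ∘ I) N     ≡⟨ count-not I N ⟩
        N                                 ∎
        where
        open ≡-Reasoning
        count-I : count I N ≡ G * 3
        count-I = trans (count-+ I m (G * 12)) (cong₂ _+_
          (count-none _ m λ k _ → blockwise-above G β k)
          (count-blocks I 3 G λ g g<G → trans (count-cong {g = β g} 12 λ j j<12 → below g<G j<12)
              (solution-count (α′ (g * 2)) (α′ (suc (g * 2))))))

    -- From a large minimal vertex cover to a satisfying assignment.

    module Soundness {S : Subset N} (S-minimal : Graph.MinimalVertexCover graph S)
        (large : N ≤ ∣ S ∣ + G * 3) where

      s I : ℕ → Bool
      s = at S
      I = not ∘ s

      S-covers : All (Covers s) edges
      S-covers = fromCover S (proj₁ S-minimal)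

      Removable : ℕ → Edge → Set
      Removable v (u , w) = (u ≡ v → s w ≡ true) × (w ≡ v → s u ≡ true)

      -- If all neighbours of `v` were in `S`, then `S` without `v` would still be a cover. This is
      -- maximality of the independent set `I`.
      maximal : ∀ {v} → v < N → s v ≡ true → ¬ All (Removable v) edges
      maximal {v} v<N v∈S safe = proj₂ S-minimal R (R⊆S , x , at⇒∈ (trans (cong s x≡v) v∈S) , x∉R)
        (toCover R (All.zipWith R-covers (All.zip (oriented , S-covers) , safe)))
        where
        x : Fin N
        x = fromℕ< v<N
        x≡v : toℕ x ≡ v
        x≡v = toℕ-fromℕ< v<N
        R : Subset N
        R = S [ x ]≔ false
        x∉R : x ∉ R
        x∉R x∈R = contradiction (trans (sym (at-[]≔ S x false)) (∈⇒at x∈R)) λ ()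
        R⊆S : ∀ {y} → y ∈ R → y ∈ S
        R⊆S {y} y∈R = at⇒∈ (trans (sym
            (at-[]≔-other S x false (λ y≡x → x∉R (subst (_∈ R) (toℕ-injective y≡x) y∈R)))) (∈⇒at y∈R))
        other : ∀ {u} → u ≢ v → s u ≡ true → at R u ≡ true
        other u≢v eq = trans (at-[]≔-other S x false (u≢v ∘ flip trans x≡v)) eq
        R-covers : ∀ {e} → (Oriented e × Covers s e) × Removable v e → Covers (at R) e
        R-covers {u , w} (((lu , lw , _) , c) , f , g) with u ≟ v | w ≟ v | c
        -- A loop at `v`, impossible because the endpoints lie on opposite sides.
        ... | yes refl | yes refl | _         = contradiction (trans (sym lu) lw) λ ()
        ... | yes u≡v  | no w≢v   | _         = inj₂ (other w≢v (f u≡v))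
        ... | no u≢v   | yes w≡v  | _         = inj₁ (other u≢v (g w≡v))
        ... | no u≢v   | no w≢v   | inj₁ u∈S  = inj₁ (other u≢v u∈S)
        ... | no u≢v   | no w≢v   | inj₂ w∈S  = inj₂ (other w≢v w∈S)

      block : ℕ → Subset 12
      block g = subset (λ j → I (j + g * 12)) 12

      I⇒s : ∀ {v} → I v ≡ false → s v ≡ true
      I⇒s = Bool.not-injective

      -- Edges to clause vertices leave the gadget, so their safety is a separate hypothesis. At
      -- `checks` it is vacuous, as clause edges meet only literals on that side; at `literals` it
      -- follows from `clauses∉I`.
      gadget-maximal : ∀ {g j} → g < G → j < 12 →
        (∀ k → All (λ l → literal l ≡ j + g * 12 → s (toℕ k + G * 12) ≡ true) (clause k)) →
        I (j + g * 12) ∨ dominated (λ q → I (q + g * 12)) j ≡ true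
      gadget-maximal {g} {j} g<G j<12 clauses-safe
        with I (j + g * 12) in v∉I | dominated (λ q → I (q + g * 12)) j in undominated
      ... | true  | _     = refl
      ... | false | true  = refl
      ... | false | false =
          contradiction (edges⁺ gadgets-safe λ k → All.map (λ {l} safe → safe , λ w≡v →
                              contradiction (<-≤-trans (block-< j<12 g<G) (m≤n+m (G * 12) (toℕ k)))
                                  (<-irrefl (sym w≡v)))
                              (clauses-safe k))
                            (maximal (≤-trans (block-< j<12 g<G) (m≤n+m (G * 12) m)) (I⇒s v∉I))
        where
        untouched = any≡false⇒All (touches (λ q → I (q + g * 12)) j) gadget undominated
        gadgets-safe : ∀ g′ → g′ < G → All (Removable (j + g * 12) ∘ shift (g′ * 12)) gadget
        gadgets-safe g′ _ = All.zipWith safe (gadget<12 , untouched)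
          where
          safe : ∀ {e} → (proj₁ e < 12 × proj₂ e < 12) × touches (λ q → I (q + g * 12)) j e ≡ false →
                 Removable (j + g * 12) (shift (g′ * 12) e)
          safe {p , q} ((p< , q<) , eq) =
              side p< (λ r≡j → proj₁ free r≡j) , side q< (λ r≡j → proj₂ free r≡j)
            where
            free = touches≡false⁻ {λ q → I (q + g * 12)} {j} {p} {q} eq
            side : ∀ {r r′} → r < 12 → (r ≡ j → I (r′ + g * 12) ≡ false) →
                r + g′ * 12 ≡ j + g * 12 → s (r′ + g′ * 12) ≡ true
            side r< f eq with block-unique {g = g′} {h = g} r< j<12 eq
            ... | r≡j , refl = I⇒s (f r≡j)

      checks-maximal : ∀ {g} → g < G → maximalAt checks (at (block g)) ≡ true
      checks-maximal {g} g<G = All⇒all≡true (λ j → at (block g) j ∨ dominated (at (block g)) j) {checks}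
        (at-check 2 ∷ at-check 3 ∷ at-check 4 ∷ at-check 5 ∷
         at-check 8 ∷ at-check 9 ∷ at-check 10 ∷ at-check 11 ∷ [])
        where
        at-check : ∀ j {_ : True (j <? 12)} {_ : True (at leftSlots j Bool.≟ false)} →
                   I (j + g * 12) ∨ dominated (λ q → I (q + g * 12)) j ≡ true
        at-check j {j<} {right} =
            gadget-maximal g<G (toWitness j<) λ k → All.map (λ {(s , i)} i< eq → contradiction
          (trans (sym (literal-left s i<)) (trans (cong isLeft eq)
            (trans (blockwise-below (λ _ → at leftSlots) g<G (toWitness j<))
                (toWitness right)))) λ ()) (variables< k)

      block≥3 : ∀ g → g < G → 3 ≤ count (λ j → I (j + g * 12)) 12
      block≥3 g g<G = ≤ᵇ⇒≤ 3 _ (subst T (sym (implies-elim (three≤ (block g)) (checks-maximal g<G))) _)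

      -- The hypothesis `large` seen from the complement: `I` has at most `G * 3` vertices, those of
      -- clauses included.
      count-I : count (λ k → I (k + G * 12)) m + count I (G * 12) ≤ G * 3
      count-I = +-cancelˡ-≤ (count s N) _ _ (begin
        count s N + (count (λ k → I (k + G * 12)) m + count I (G * 12))
            ≡⟨ cong (count s N +_) (count-+ I m (G * 12)) ⟨
        count s N + count I N     ≡⟨ count-not s N ⟩
        N                         ≤⟨ large ⟩
        ∣ S ∣ + G * 3             ≡⟨ cong (_+ G * 3) (∣∣≡count S) ⟩
        count s N + G * 3         ∎)
        where open ≤-Reasoning

      block≤3 : ∀ {g} → g < G → count (λ j → I (j + g * 12)) 12 ≤ 3
      block≤3 = count-blocks-tight I 3 G block≥3 (m+n≤o⇒n≤o _ count-I)

      -- The gadgets alone use up the whole budget `G * 3`.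
      clauses∉I : ∀ (k : Fin m) → I (toℕ k + G * 12) ≡ false
      clauses∉I k = count≡0 (λ k → I (k + G * 12)) m
        (+-cancelʳ-≤ (G * 3) _ 0 (≤-trans (+-monoʳ-≤ _ (count-blocks-≥ I 3 G block≥3)) count-I))
            (toℕ<n k)

      literals-maximal : ∀ {g} → g < G → maximalAt literals (at (block g)) ≡ true
      literals-maximal {g} g<G =
          All⇒all≡true (λ j → at (block g) j ∨ dominated (at (block g)) j) {literals}
        (at-literal 0 ∷ at-literal 1 ∷ at-literal 6 ∷ at-literal 7 ∷ [])
        where
        at-literal : ∀ j {_ : True (j <? 12)} →
            I (j + g * 12) ∨ dominated (λ q → I (q + g * 12)) j ≡ true
        at-literal j {j<} = gadget-maximal g<G (toWitness j<) λ k →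
            All.universal (λ l _ → I⇒s (clauses∉I k)) (clause k)

      block-independent : ∀ {g} → g < G → independent (at (block g)) ≡ true
      block-independent {g} g<G =
          All⇒all≡true (λ (p , q) → not (at (block g) p ∧ at (block g) q)) (All.zipWith
        (λ {(p , q)} ((p< , q<) , c) → cong not (trans
          (cong₂ _∧_ (at-subset (λ j → I (j + g * 12)) 12 p<)
              (at-subset (λ j → I (j + g * 12)) 12 q<)) (not-both c)))
        (gadget<12 , proj₁ (edges⁻ S-covers) g<G))
        where
        not-both : ∀ {u w} → Covers s (u , w) → I u ∧ I w ≡ false
        not-both (inj₁ eq) rewrite eq = refl
        not-both {u} (inj₂ eq) rewrite eq = Bool.∧-zeroʳ (I u)

      exactly-one : ∀ {g} → g < G → (I (0 + g * 12) xor I (1 + g * 12)) ≡ true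
                                  × (I (6 + g * 12) xor I (7 + g * 12)) ≡ true
      exactly-one {g} g<G =
          Bool.∧-conicalˡ _ _ both , Bool.∧-conicalʳ ((I (0 + g * 12) xor I (1 + g * 12))) _ both
        where
        both : (I (0 + g * 12) xor I (1 + g * 12)) ∧ (I (6 + g * 12) xor I (7 + g * 12)) ≡ true
        both = implies-elim (assigns (block g))
            (cong₂ _∧_ (block-independent g<G) (cong₂ _∧_ (literals-maximal g<G)
          (cong₂ _∧_ (checks-maximal g<G) (Equivalence.to Bool.T-≡ (≤⇒≤ᵇ (block≤3 g<G))))))

      α : Fin vars → Bool
      α i = I (toℕ i * 6)

      literal⇒α : ∀ b (i : Fin vars) → I (literal (b , toℕ i)) ≡ true → α i ≡ b
      literal⇒α true  i eq = eq
      literal⇒α false i eq = go (slot (toℕ<n i))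
        where
        go : Slot vars (toℕ i) → α i ≡ false
        go (even {h} h< eq′) = xor-not (α i) _ (subst (λ z → (I z xor I (suc z)) ≡ true)
          (sym (trans (cong (_* 6) eq′) (*-assoc h 2 6))) (proj₁ (exactly-one h<))) eq
        go (odd {h} h< eq′) = xor-not (α i) _ (subst (λ z → (I z xor I (suc z)) ≡ true)
          (sym (trans (cong (_* 6) eq′) (cong (6 +_) (*-assoc h 2 6)))) (proj₂ (exactly-one h<))) eq

      -- The clause vertex lies in `S`. With no literal of the clause in `I`, all its neighbours
      -- would be in `S` and it could be removed.
      clause-satisfied : ∀ k → Any (λ l → I (literal l) ≡ true) (clause k)
      clause-satisfied k with Any.any? (λ l → I (literal l) Bool.≟ true) (clause k)
      ... | yes p = p
      ... | no ¬p = contradiction (edges⁺ gadgets-safe clauses-safe)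
          (maximal (clauseVertex<N k) (I⇒s (clauses∉I k)))
        where
        v = toℕ k + G * 12
        below≢v : ∀ {u} → u < G * 12 → u ≢ v
        below≢v u< refl = contradiction u< (≤⇒≯ (m≤n+m (G * 12) (toℕ k)))
        gadgets-safe : ∀ g → g < G → All (Removable v ∘ shift (g * 12)) gadget
        gadgets-safe g g<G = All.map (λ (p< , q<) → (λ eq → contradiction eq (below≢v (block-< p< g<G)))
                                                  , (λ eq → contradiction eq
                                                      (below≢v (block-< q< g<G)))) gadget<12
        clauses-safe : ∀ k′ → All (λ l → Removable v (literal l , toℕ k′ + G * 12)) (clause k′)
        clauses-safe k′ = All.zipWith (λ {(b , i)} (i< , unsat) →
            (λ eq → contradiction eq (below≢v (left<N (literal-left b i<))))
          , (λ eq → I⇒s (Bool.¬-not (unsat eq)))) (variables< k′ , unsatisfied)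
          where
          unsatisfied : All (λ l → toℕ k′ + G * 12 ≡ v → I (literal l) ≢ true) (clause k′)
          -- Distinct clauses have distinct vertices, so for another clause the condition is
          -- vacuous.
          unsatisfied with k′ Fin.≟ k
          ... | yes refl = All.map (λ ¬l _ → ¬l) (All.¬Any⇒All¬ (clause k) ¬p)
          ... | no k′≢k  = All.universal
              (λ l eq → contradiction (toℕ-injective (+-cancelʳ-≡ (G * 12) _ _ eq)) k′≢k) (clause k′)

      satisfiable : Satisfiable
      satisfiable = α , All.map (λ c → Any.map (λ {(b , i)} → literal⇒α b i) (Any.map⁻ c))
        (All.map⁻ (All.tabulate λ c∈ →
            subst (Any (λ l → I (literal l) ≡ true)) (sym (Any.lookup-index c∈))
                                             (clause-satisfied (Any.index c∈))))

-- The SAT algorithm built around a program for MMVC.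

open import Data.Fin.Base using (Fin; zero; suc; punchIn)
open import Data.Fin.Subset.Properties using (∣p∣≤n)
open import Data.Nat.Base hiding (_<_; _⊓_)
open import Data.Nat.GeneralisedArithmetic using (iterate)
open import Data.Nat.Properties
open import Data.Product.Base using (∃-syntax; _×_; _,_; proj₁; proj₂)
open import Data.Rational.Base using (ℚ; 0ℚ; 1ℚ; _<_; _⊓_)
open import Data.Vec.Base using (_∷_; lookup; _[_]≔_; replicate)
open import Function.Base using (_∘_)
open import Relation.Binary.PropositionalEquality
open import Relation.Nullary.Negation.Core using (¬_)
open import Relation.Nullary.Reflects using (Reflects; ofʸ; ofⁿ)
open RationalBounds using (root-bound; total-bound; 0≤2−; 2−-mono; 1≤2−; 2−≤2; 0<ε⊓1)
open PolynomialTime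
open GraphOfFormula using (module Construction)

open PolyTime

-- Makes room for v₁ in front of the auxiliary variables.
skip : ∀ {m} → Fin (suc m) → Fin (2 + m)
skip = punchIn (suc zero)

renameExpr : ∀ {m} → Expr (suc m) → Expr (2 + m)
renameExpr nil        = nil
renameExpr (var x)    = var (skip x)
renameExpr (cons e f) = cons (renameExpr e) (renameExpr f)
renameExpr (hd e)     = hd (renameExpr e)
renameExpr (tl e)     = tl (renameExpr e)

rename : ∀ {m} → Cmd (suc m) → Cmd (2 + m)
rename (x := e)               = skip x := renameExpr e
rename (c ⨾ d)                = rename c ⨾ rename d
rename (if e then c else d)   = if renameExpr e then rename c else rename d
rename (while e repeat c)     = while renameExpr e repeat rename c

insert : ∀ {m} → Tree → Store (suc m) → Store (2 + m)
insert s (x ∷ ρ) = x ∷ s ∷ ρ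

lookup-insert : ∀ {m} s (σ : Store (suc m)) x → lookup (insert s σ) (skip x) ≡ lookup σ x
lookup-insert s (y ∷ ρ) zero    = refl
lookup-insert s (y ∷ ρ) (suc x) = refl

insert-[]≔ : ∀ {m} s (σ : Store (suc m)) x v → insert s σ [ skip x ]≔ v ≡ insert s (σ [ x ]≔ v)
insert-[]≔ s (y ∷ ρ) zero    v = refl
insert-[]≔ s (y ∷ ρ) (suc x) v = refl

eval-rename : ∀ {m} (e : Expr (suc m)) s σ → eval (renameExpr e) (insert s σ) ≡ eval e σ
eval-rename nil        s σ = refl
eval-rename (var x)    s σ = lookup-insert s σ x
eval-rename (cons e f) s σ = cong₂ _∙_ (eval-rename e s σ) (eval-rename f s σ)
eval-rename (hd e)     s σ = cong head (eval-rename e s σ)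
eval-rename (tl e)     s σ = cong tail (eval-rename e s σ)

cost-rename : ∀ {m} (e : Expr (suc m)) → cost (renameExpr e) ≡ cost e
cost-rename nil        = refl
cost-rename (var x)    = refl
cost-rename (cons e f) = cong₂ (λ x y → suc (x + y)) (cost-rename e) (cost-rename f)
cost-rename (hd e)     = cong suc (cost-rename e)
cost-rename (tl e)     = cong suc (cost-rename e)

-- Unlike `PolyTime` code, the given program is tied to its own variables. Renaming them around `v₁`
-- lets the data for the final test survive its run at the same cost.
rename-runs : ∀ {m} {c : Cmd (suc m)} {σ τ t} s → ⟨ c , σ ⟩⇓⟨ τ , t ⟩ →
              ⟨ rename c , insert s σ ⟩⇓⟨ insert s τ , t ⟩
rename-runs s (assign {x} {e} {σ}) =
    subst₂ (λ τ t → ⟨ skip x := renameExpr e , insert s σ ⟩⇓⟨ τ , suc t ⟩)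
  (trans (insert-[]≔ s σ x _) (cong (λ v → insert s (σ [ x ]≔ v)) (eval-rename e s σ)))
      (cost-rename e) assign
rename-runs s (seq c⇓ d⇓) = seq (rename-runs s c⇓) (rename-runs s d⇓)
rename-runs s (if-true {e} {σ = σ} e≢nil c⇓) rewrite sym (cost-rename e) =
  if-true (e≢nil ∘ trans (sym (eval-rename e s σ))) (rename-runs s c⇓)
rename-runs s (if-false {e} {σ = σ} e≡nil d⇓) rewrite sym (cost-rename e) =
  if-false (trans (eval-rename e s σ) e≡nil) (rename-runs s d⇓)
rename-runs s (while-true {e} {ρ = σ} e≢nil c⇓ w⇓) rewrite sym (cost-rename e) =
  while-true (e≢nil ∘ trans (sym (eval-rename e s σ))) (rename-runs s c⇓) (rename-runs s w⇓)
rename-runs s (while-false {e} {σ = σ} e≡nil) rewrite sym (cost-rename e) =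
  while-false (trans (eval-rename e s σ) e≡nil)

iterate-pred : ∀ n k → iterate pred n k ≡ n ∸ k
iterate-pred n       zero    = refl
iterate-pred zero    (suc k) = trans (iterate-pred zero k) (0∸n≡0 k)
iterate-pred (suc n) (suc k) = iterate-pred n k

iterate-pred³ : ∀ n g → iterate (pred ∘ pred ∘ pred) n g ≡ n ∸ g * 3
iterate-pred³ n zero    = refl
iterate-pred³ n (suc g) = begin
  iterate (pred ∘ pred ∘ pred) (pred (pred (pred n))) g ≡⟨ iterate-pred³ (pred (pred (pred n))) g ⟩
  pred (pred (pred n)) ∸ g * 3                          ≡⟨ cong (_∸ g * 3) (iterate-pred n 3) ⟩
  n ∸ 3 ∸ g * 3                                         ≡⟨ ∸-+-assoc n 3 (g * 3) ⟩
  n ∸ suc g * 3                                         ∎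
  where open ≡-Reasoning

test-reflects : ∀ k n g → Reflects (n ≤ k + g * 3) (test (k , (n , g)))
test-reflects k n g rewrite iterate-pred n k | iterate-pred³ (n ∸ k) g | ∸-+-assoc n k (g * 3)
  with n ∸ (k + g * 3) in eq
... | zero  = ofʸ (m∸n≡0⇒m≤n eq)
... | suc _ = ofⁿ λ n≤ → 1+n≢0 (trans (sym eq) (m≤n⇒m∸n≡0 n≤))

mapReflects : ∀ {P Q : Set} {b} → (P → Q) → (Q → P) → Reflects P b → Reflects Q b
mapReflects f g (ofʸ p)  = ofʸ (f p)
mapReflects f g (ofⁿ ¬p) = ofⁿ (¬p ∘ g)

size-encodeℕ-mono : ∀ {m n} → m ≤ n → size (encodeℕ m) ≤ size (encodeℕ n)
size-encodeℕ-mono {n = n} z≤n = size≥1 (encodeℕ n)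
size-encodeℕ-mono (s≤s m≤n)   = +-monoʳ-≤ 2 (size-encodeℕ-mono m≤n)

⌈n/2⌉*2≤1+n : ∀ n → ⌈ n /2⌉ * 2 ≤ suc n
⌈n/2⌉*2≤1+n zero          = z≤n
⌈n/2⌉*2≤1+n (suc zero)    = ≤-refl
⌈n/2⌉*2≤1+n (suc (suc n)) = +-monoʳ-≤ 2 (⌈n/2⌉*2≤1+n n)

-- The graph is handed to the MMVC program, while its order and the number of gadgets are set aside
-- for `test`.
preparation : RawCNF → Partial × (ℕ × ℕ)
preparation (n , cs) = reduction (n , cs) , (proj₁ (reduction (n , cs)) , ⌈ n /2⌉)

opaque
  preparationᴾ : PolyTime CNF.encodeCNF (encodePair encodePartial (encodePair encodeℕ encodeℕ))
                          (preparation ∘ Construction.raw)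
  preparationᴾ = recode Construction.raw Construction.encode-raw
    (pair reductionᴾ (pair (first ⊚ reductionᴾ) (halfᴾ ⊚ first)))

power : Poly → ℕ → Poly
power P zero    = con 1
power P (suc b) = P ⊗ power P b

⟦power⟧ : ∀ P b n → ⟦ power P b ⟧ n ≡ ⟦ P ⟧ n ^ b
⟦power⟧ P zero    n = refl
⟦power⟧ P (suc b) n = cong (⟦ P ⟧ n *_) (⟦power⟧ P b n)

module Solver (p : Program) where

  satSolver : Program
  satSolver = record
    { auxVars = suc (Program.auxVars p)
    ; body    = code preparationᴾ ⨾
                v₁ := tl x₀ ⨾ v₀ := hd x₀ ⨾
                rename (Program.body p) ⨾
                v₀ := cons x₀ x₁ ⨾
                code testᴾ
    }

  overhead : Poly
  -- 10 is the cost of the three assignments between the phases. `grow preparationᴾ` occurs twice,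
  -- for the saved data and for the MMVC value, which is at most the order.
  overhead = time preparationᴾ ⊕ con 10 ⊕ time testᴾ ⊙ (con 1 ⊕ grow preparationᴾ ⊕ grow preparationᴾ)

  module _ (φ : CNF) where
    open Construction φ

    solves : ∀ {K t} → K ≤ N → p on Graph.encodeGraph graph ↦ encodeℕ K inTime t →
      ∃[ T ] satSolver on CNF.encodeCNF φ ↦ encodeBool (test (K , (N , G))) inTime T
           × T ≤ ⟦ overhead ⟧ (size (CNF.encodeCNF φ)) + t
    solves {K} {t} K≤N run = subst
      (λ n → ∃[ T ] satSolver on CNF.encodeCNF φ ↦ encodeBool (test (K , (n , G))) inTime T
                  × T ≤ ⟦ overhead ⟧ s + t)
      (cong proj₁ reduction-raw)
      (solves′ (subst (λ z → p on z ↦ encodeℕ K inTime t) encode-graph run))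
      where
      open ≤-Reasoning
      s = size (CNF.encodeCNF φ)
      info : Tree
      info = encodePair encodeℕ encodeℕ (proj₁ (reduction raw) , G)
      info≤ : size info ≤ ⟦ grow preparationᴾ ⟧ s
      info≤ = m+n≤o⇒n≤o (suc (size (encodePartial (reduction raw)))) (grows preparationᴾ φ)
      K≤ : size (encodeℕ K) ≤ ⟦ grow preparationᴾ ⟧ s
      K≤ = begin
        size (encodeℕ K)                       ≤⟨ size-encodeℕ-mono K≤N ⟩
        size (encodeℕ N)                       ≡⟨ cong (size ∘ encodeℕ ∘ proj₁) reduction-raw ⟨
        size (encodeℕ (proj₁ (reduction raw))) ≤⟨ m≤n⇒m≤1+n (m≤m+n _ _) ⟩
        size info                              ≤⟨ info≤ ⟩
        ⟦ grow preparationᴾ ⟧ s                ∎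
      bound : ∀ {tₚ tₜ} → tₚ ≤ ⟦ time preparationᴾ ⟧ s →
          tₜ ≤ ⟦ time testᴾ ⟧ (suc (size (encodeℕ K) + size info)) →
              tₚ + (3 + (3 + (t + (4 + tₜ)))) ≤ ⟦ overhead ⟧ s + t
      bound {tₚ} {tₜ} tₚ≤ tₜ≤ = begin
        tₚ + (6 + (t + (4 + tₜ)))   ≡⟨ cong (λ z → tₚ + (6 + z)) (+-comm t (4 + tₜ)) ⟩
        tₚ + (10 + (tₜ + t))        ≡⟨ +-assoc tₚ (10 + tₜ) t ⟨
        tₚ + (10 + tₜ) + t          ≤⟨ +-monoˡ-≤ t (+-mono-≤ tₚ≤ (+-monoʳ-≤ 10 (≤-trans tₜ≤
                                         (⟦⟧-mono (time testᴾ) (s≤s (+-mono-≤ K≤ info≤)))))) ⟩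
        ⟦ overhead ⟧ s + t          ∎
      solves′ : p on encodePartial (reduction raw) ↦ encodeℕ K inTime t →
        ∃[ T ] satSolver on CNF.encodeCNF φ ↦ encodeBool
            (test (K , (proj₁ (reduction raw) , G))) inTime T
             × T ≤ ⟦ overhead ⟧ s + t
      solves′ (y ∷ ρ , p⇓ , refl) =
        -- `p` needs its auxiliary variables to be nil at the start, and the preparation leaves them
        -- so. Whatever `p` leaves in `ρ` is harmless, since `testᴾ` runs beside any store.
        let tₚ , prep⇓ , tₚ≤ = runs preparationᴾ φ nil (replicate (Program.auxVars p) nil)
            tₜ , test⇓ , tₜ≤ = runs testᴾ (K , (proj₁ (reduction raw) , G)) info ρ
        in tₚ + (3 + (3 + (t + (4 + tₜ)))) ,
           (_ , seq prep⇓ (seq assign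
               (seq assign (seq (rename-runs info p⇓) (seq assign test⇓)))) , refl) ,
           bound tₚ≤ tₜ≤

    -- Soundness is applied to an optimal cover; completeness exhibits a minimal cover that meets
    -- the threshold with equality, and `largest` compares it with the optimum.
    reflects : ∀ {K} → Graph.IsMMVC graph K → Reflects (CNF.Satisfiable φ) (test (K , (N , G)))
    reflects {K} ((S , S-minimal , refl) , largest) = mapReflects (Soundness.satisfiable S-minimal)
      (λ (α , sat) → let module C = Completeness α sat in
        ≤-trans (≤-reflexive (sym C.∣S∣)) (+-monoˡ-≤ (G * 3) (largest C.S (C.S-cover , C.S-minimal))))
      (test-reflects K N G)

    mmvc≤N : ∀ {K} → Graph.IsMMVC graph K → K ≤ N
    mmvc≤N ((S , _ , refl) , _) = ∣p∣≤n S

    vc≤2n : ∀ {k} → Graph.IsVc graph k → k ≤ suc (CNF.vars φ) + suc (CNF.vars φ)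
    vc≤2n {k} isVc = begin
      k                   ≤⟨ vc≤ k isVc ⟩
      G * 4               ≡⟨ *-distribˡ-+ G 2 2 ⟩
      G * 2 + G * 2       ≤⟨ +-mono-≤ (⌈n/2⌉*2≤1+n (CNF.vars φ)) (⌈n/2⌉*2≤1+n (CNF.vars φ)) ⟩
      suc (CNF.vars φ) + suc (CNF.vars φ) ∎
      where open ≤-Reasoning

    graph-size : size (Graph.encodeGraph graph) ≤ ⟦ grow preparationᴾ ⟧ (size (CNF.encodeCNF φ))
    graph-size = ≤-trans (≤-reflexive (cong size encode-graph))
      (≤-trans (m≤n⇒m≤1+n (m≤m+n _ _)) (grows preparationᴾ φ))

sat-solvable : ∀ {ε} → 0ℚ < ε → SolvableInO* BipartiteMMVC (2− ε) vc 2 → ∀ k →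
               SolvableInO* (k -SAT) (2− (ε ⊓ 1ℚ)) (λ (φ , _) n → CNF.vars φ ≡ n) 1
sat-solvable {ε} 0<ε (p , a , b , solve) k = satSolver , A , B , λ (φ , _) → answer φ
  where
  open Solver p

  -- The factor 2 comes from rounding the number of variables up to an even number.
  bound : Poly
  bound = overhead ⊕ (con a ⊗ power (grow preparationᴾ) b) ⊗ con 2

  A B : ℕ
  A = proj₁ (monomialBound bound)
  B = proj₁ (proj₂ (monomialBound bound))

  answer : ∀ φ → ∃[ out ] ∃[ t ] ∃[ n ]
      (satSolver on CNF.encodeCNF φ ↦ out inTime t)
    × (∃[ b ] out ≡ encodeBool b × Reflects (CNF.Satisfiable φ) b)
    × CNF.vars φ ≡ n
    × t ≤ A * size (CNF.encodeCNF φ) ^ B · 2− (ε ⊓ 1ℚ) ^⟨ n / 1 ⟩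
  answer φ =
    let open Construction φ
        _ , t , vc , run , (K , out≡ , mmvc) , isVc , t≤ = solve (graph , bipartite)
        T , runs , T≤ = solves φ (mmvc≤N φ mmvc)
            (subst (λ o → p on Graph.encodeGraph graph ↦ o inTime t) out≡ run)
        s = size (CNF.encodeCNF φ)
        q = a * size (Graph.encodeGraph graph) ^ b
        q≤ : q ≤ a * ⟦ power (grow preparationᴾ) b ⟧ s
        q≤ = *-monoʳ-≤ a (≤-trans (^-monoˡ-≤ b (graph-size φ))
            (≤-reflexive (sym (⟦power⟧ (grow preparationᴾ) b s))))
    in _ , T , CNF.vars φ , runs , (_ , refl , reflects φ mmvc) , refl ,
       total-bound {u = ⟦ overhead ⟧ s} {t = t} {q = q * 2} {n = CNF.vars φ} (1≤2− 0<ε) T≤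
         (≤-trans (+-monoʳ-≤ (⟦ overhead ⟧ s) (*-monoˡ-≤ 2 q≤))
                  (proj₂ (proj₂ (monomialBound bound)) s {{>-nonZero (size≥1 (CNF.encodeCNF φ))}}))
         (root-bound {t = t} {q} {k = vc} (0≤2− ε) (2−-mono 0<ε) (1≤2− 0<ε) (2−≤2 0<ε)
             (vc≤2n φ isVc) t≤)

lemma2 : ∀ (ε : ℚ) → 0ℚ < ε → SETH → ¬ SolvableInO* BipartiteMMVC (2− ε) vc 2
lemma2 ε 0<ε seth solvable = let k , unsolvable = seth (ε ⊓ 1ℚ) (0<ε⊓1 0<ε) in
  unsolvable (sat-solvable 0<ε solvable k)
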